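{- Let $p$ and $q$ be two odd prime numbers with $p < q$. Then the Sombor index of the total graph $T_\Gamma(\mathbb{Z}_{pq})$ is $$SO(T_\Gamma(\mathbb{Z}_{pq})) = \sqrt{2}\,\alpha\,(pq-\phi(pq)-1) + \beta\sqrt{(pq-\phi(pq)-1)^2+(pq-\phi(pq))^2} + \sqrt{2}\,(|E|-\alpha-\beta)(pq-\phi(pq)),$$ where $$\alpha = \frac{p(p-1)+q(q-1)}{2},\qquad \beta = 2(p-1)(q-1),\qquad |E| = \frac{(pq-1)(p+q-1)}{2}.$$
   Context: For a finite simple graph $G$, the Sombor index is $SO(G)=\sum_{uv\in E(G)}\sqrt{d_u^2+d_v^2}$, the sum being over (unordered) edges, where $d_x$ is the degree of the vertex $x$. For a commutative ring $R$ with unity, $Z(R)$ denotes the set of zero-divisors of $R$, including $0$. The total graph $T_\Gamma(R)$ is the simple graph whose vertices are all elements of $R$, with distinct vertices $x,y$ adjacent if and only if $x+y\in Z(R)$. $\mathbb{Z}_n$ is the ring of integers modulo $n$ and $\phi$ is Euler's totient function. -}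

module Defs where

open import Algebra.Bundles using (CommutativeRing)
open import Data.Fin.Base using (Fin; toℕ) renaming (_<_ to _<ᶠ_)
import Data.Fin.Properties as Fin
open import Data.Integer.Base as ℤ using (+_; -[1+_])
import Data.Integer.Properties as ℤ
open import Data.List.Base using (List; map; filter; foldr; length; upTo; allFin; cartesianProduct)
open import Data.Nat.Base as ℕ using (ℕ; zero; suc; NonZero)
open import Data.Nat.Coprimality using (coprime?)
open import Data.Nat.DivMod using (_%_; _mod_; m%n<n; m<n⇒m%n≡m; m%n%n≡m%n; n%n≡0; %-distribˡ-+; %-distribˡ-*)
import Data.Nat.Properties as ℕ
open import Data.Nat.Tactic.RingSolver using (solve-∀)
open import Data.Product using (∃-syntax; _×_; _,_; proj₁; proj₂)
open import Data.Rational.Base as ℚ using (ℚ; mkℚ; 0ℚ; 1ℚ; _/_; Positive; positive; *<*; ∣_∣)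
import Data.Rational.Properties as ℚ
open import Data.Rational.Solver using (module +-*-Solver)
open import Data.Rational.Unnormalised.Base as ℚᵘ using (mkℚᵘ)
import Data.Rational.Unnormalised.Properties as ℚᵘ
open import Data.Sum.Base using (_⊎_; inj₁; inj₂)
open import Level as L using (Level; 0ℓ; _⊔_)
open import Relation.Binary.Core using (Rel)
open import Relation.Binary.Definitions using (Decidable; Symmetric)
open import Relation.Binary.PropositionalEquality
open import Relation.Nullary using (¬_; Dec; yes; no)
open import Relation.Nullary.Decidable using (¬?; _×-dec_; _⊎-dec_)
import Relation.Unary as U

private variable
  a c ℓ : Level
  n : ℕ

IsCauchy : (ℕ → ℚ) → Set
IsCauchy x = ∀ ε → 0ℚ ℚ.< ε → ∃[ N ] ∀ i j → N ℕ.≤ i → N ℕ.≤ j → ∣ x i ℚ.- x j ∣ ℚ.< ε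

record ℝ : Set where
  constructor mkℝ
  field
    seq    : ℕ → ℚ
    cauchy : IsCauchy seq

open ℝ public

infix  4 _≃_
infixl 6 _+ᴿ_
infixl 7 _*ᴿ_

-- Equality of real numbers is equality of limits, not of sequences.
_≃_ : ℝ → ℝ → Set
x ≃ y = ∀ ε → 0ℚ ℚ.< ε → ∃[ N ] ∀ i → N ℕ.≤ i → ∣ seq x i ℚ.- seq y i ∣ ℚ.< ε

fromℚ : ℚ → ℝ
fromℚ r = mkℝ (λ _ → r) λ ε 0<ε → 0 , λ _ _ _ _ →
  subst (ℚ._< ε) (cong ∣_∣ (sym (ℚ.+-inverseʳ r))) 0<ε

fromℕ : ℕ → ℝ
fromℕ n = fromℚ (+ n / 1)

0ᴿ : ℝ
0ᴿ = fromℕ 0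

half-pos : ∀ {ε} → 0ℚ ℚ.< ε → 0ℚ ℚ.< ℚ.½ ℚ.* ε
half-pos {ε} 0<ε = subst (ℚ._< ℚ.½ ℚ.* ε) (ℚ.*-zeroʳ ℚ.½) (ℚ.*-monoʳ-<-pos ℚ.½ 0<ε)

half+half : ∀ ε → ℚ.½ ℚ.* ε ℚ.+ ℚ.½ ℚ.* ε ≡ ε
half+half ε = trans (sym (ℚ.*-distribʳ-+ ε ℚ.½ ℚ.½)) (ℚ.*-identityˡ ε)

+-cauchy : ∀ {x y} → IsCauchy x → IsCauchy y → IsCauchy (λ i → x i ℚ.+ y i)
+-cauchy {x} {y} cx cy ε 0<ε with cx _ (half-pos 0<ε) | cy _ (half-pos 0<ε)
... | M , px | N , py = M ℕ.⊔ N , λ i j hi hj → let open ℚ.≤-Reasoning in begin-strict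
  ∣ (x i ℚ.+ y i) ℚ.- (x j ℚ.+ y j) ∣       ≡⟨ cong ∣_∣ (regroup (x i) (y i) (x j) (y j)) ⟩
  ∣ (x i ℚ.- x j) ℚ.+ (y i ℚ.- y j) ∣       ≤⟨ ℚ.∣p+q∣≤∣p∣+∣q∣ (x i ℚ.- x j) (y i ℚ.- y j) ⟩
  ∣ x i ℚ.- x j ∣ ℚ.+ ∣ y i ℚ.- y j ∣       <⟨ ℚ.+-mono-<
      (px i j (ℕ.m⊔n≤o⇒m≤o M N hi) (ℕ.m⊔n≤o⇒m≤o M N hj))
      (py i j (ℕ.m⊔n≤o⇒n≤o M N hi) (ℕ.m⊔n≤o⇒n≤o M N hj)) ⟩
  ℚ.½ ℚ.* ε ℚ.+ ℚ.½ ℚ.* ε                   ≡⟨ half+half ε ⟩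
  ε                                         ∎
  where
  open +-*-Solver
  regroup : ∀ p q r s → (p ℚ.+ q) ℚ.- (r ℚ.+ s) ≡ (p ℚ.- r) ℚ.+ (q ℚ.- s)
  regroup = solve 4 (λ p q r s → (p :+ q) :+ (:- (r :+ s)) := (p :+ (:- r)) :+ (q :+ (:- s))) refl

bounded : ∀ {x} → IsCauchy x → ∃[ B ] Positive B × ∃[ N ] ∀ i → N ℕ.≤ i → ∣ x i ∣ ℚ.≤ B
bounded {x} cx with cx 1ℚ (ℚ.positive⁻¹ 1ℚ)
... | N , px = ∣ x N ∣ ℚ.+ 1ℚ
             , ℚ.nonNeg+pos⇒pos ∣ x N ∣ {{ℚ.∣-∣-nonNeg (x N)}} 1ℚ
             , N , λ i hi → let open ℚ.≤-Reasoning in begin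
  ∣ x i ∣                            ≡⟨ cong ∣_∣ (split (x i) (x N)) ⟩
  ∣ x N ℚ.+ (x i ℚ.- x N) ∣          ≤⟨ ℚ.∣p+q∣≤∣p∣+∣q∣ (x N) (x i ℚ.- x N) ⟩
  ∣ x N ∣ ℚ.+ ∣ x i ℚ.- x N ∣        ≤⟨ ℚ.+-monoʳ-≤ ∣ x N ∣ (ℚ.<⇒≤ (px i N hi ℕ.≤-refl)) ⟩
  ∣ x N ∣ ℚ.+ 1ℚ                     ∎
  where
  open +-*-Solver
  split : ∀ p q → p ≡ q ℚ.+ (p ℚ.- q)
  split = solve 2 (λ p q → p := q :+ (p :+ (:- q))) refl

divide-pos : ∀ C → Positive C → ∀ ε → 0ℚ ℚ.< ε → ∃[ δ ] 0ℚ ℚ.< δ × C ℚ.* δ ≡ ε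
divide-pos C C>0 ε 0<ε = r ℚ.* ε , subst (ℚ._< r ℚ.* ε) (ℚ.*-zeroʳ r) (ℚ.*-monoʳ-<-pos r {{r>0}} 0<ε) , (begin
  C ℚ.* (r ℚ.* ε)    ≡⟨ ℚ.*-assoc C r ε ⟨
  C ℚ.* r ℚ.* ε      ≡⟨ cong (ℚ._* ε) (ℚ.*-inverseʳ C {{C≢0}}) ⟩
  1ℚ ℚ.* ε           ≡⟨ ℚ.*-identityˡ ε ⟩
  ε                  ∎)
  where
  open ≡-Reasoning
  C≢0 = ℚ.pos⇒nonZero C {{C>0}}
  r = ℚ.1/_ C {{C≢0}}
  r>0 : Positive r
  r>0 = ℚ.1/pos⇒pos C {{C>0}}

*-telescope : ∀ p q r s → p ℚ.* q ℚ.- r ℚ.* s ≡ p ℚ.* (q ℚ.- s) ℚ.+ s ℚ.* (p ℚ.- r)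
*-telescope = solve 4 (λ p q r s → p :* q :+ (:- (r :* s)) := p :* (q :+ (:- s)) :+ s :* (p :+ (:- r))) refl
  where open +-*-Solver

∣*∣-mono-< : ∀ {C δ} u v → Positive C → ∣ u ∣ ℚ.≤ C → ∣ v ∣ ℚ.< δ → ∣ u ℚ.* v ∣ ℚ.< C ℚ.* δ
∣*∣-mono-< {C} {δ} u v C>0 u≤C v<δ = begin-strict
  ∣ u ℚ.* v ∣         ≡⟨ ℚ.∣p*q∣≡∣p∣*∣q∣ u v ⟩
  ∣ u ∣ ℚ.* ∣ v ∣     ≤⟨ ℚ.*-monoʳ-≤-nonNeg ∣ v ∣ {{ℚ.∣-∣-nonNeg v}} u≤C ⟩
  C ℚ.* ∣ v ∣         <⟨ ℚ.*-monoʳ-<-pos C {{C>0}} v<δ ⟩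
  C ℚ.* δ             ∎
  where open ℚ.≤-Reasoning

∣*-*∣-< : ∀ {A B δ} p q r s → Positive A → Positive B →
          ∣ p ∣ ℚ.≤ A → ∣ s ∣ ℚ.≤ B → ∣ p ℚ.- r ∣ ℚ.< δ → ∣ q ℚ.- s ∣ ℚ.< δ →
          ∣ p ℚ.* q ℚ.- r ℚ.* s ∣ ℚ.< (A ℚ.+ B) ℚ.* δ
∣*-*∣-< {A} {B} {δ} p q r s A>0 B>0 p≤A s≤B p-r q-s = begin-strict
  ∣ p ℚ.* q ℚ.- r ℚ.* s ∣                               ≡⟨ cong ∣_∣ (*-telescope p q r s) ⟩
  ∣ p ℚ.* (q ℚ.- s) ℚ.+ s ℚ.* (p ℚ.- r) ∣               ≤⟨ ℚ.∣p+q∣≤∣p∣+∣q∣ (p ℚ.* (q ℚ.- s)) (s ℚ.* (p ℚ.- r)) ⟩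
  ∣ p ℚ.* (q ℚ.- s) ∣ ℚ.+ ∣ s ℚ.* (p ℚ.- r) ∣           <⟨ ℚ.+-mono-<
    (∣*∣-mono-< {A} {δ} p (q ℚ.- s) A>0 p≤A q-s) (∣*∣-mono-< {B} {δ} s (p ℚ.- r) B>0 s≤B p-r) ⟩
  A ℚ.* δ ℚ.+ B ℚ.* δ                                   ≡⟨ ℚ.*-distribʳ-+ δ A B ⟨
  (A ℚ.+ B) ℚ.* δ                                       ∎
  where open ℚ.≤-Reasoning

*-cauchy : ∀ {x y} → IsCauchy x → IsCauchy y → IsCauchy (λ i → x i ℚ.* y i)
*-cauchy {x} {y} cx cy ε 0<ε = (K ℕ.⊔ L) ℕ.⊔ (M ℕ.⊔ N) , λ i j hi hj →
  subst (∣ x i ℚ.* y i ℚ.- x j ℚ.* y j ∣ ℚ.<_) Cδ≡ε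
    (∣*-*∣-< {A} {B} {δ} (x i) (y i) (x j) (y j) A>0 B>0
      (x≤A i (ℕ.m⊔n≤o⇒m≤o K L (KL hi))) (y≤B j (ℕ.m⊔n≤o⇒n≤o K L (KL hj)))
      (x-x i j (ℕ.m⊔n≤o⇒m≤o M N (MN hi)) (ℕ.m⊔n≤o⇒m≤o M N (MN hj)))
      (y-y i j (ℕ.m⊔n≤o⇒n≤o M N (MN hi)) (ℕ.m⊔n≤o⇒n≤o M N (MN hj))))
  where
  bx = bounded cx
  by = bounded cy
  A = proj₁ bx
  B = proj₁ by
  A>0 = proj₁ (proj₂ bx)
  B>0 = proj₁ (proj₂ by)
  K = proj₁ (proj₂ (proj₂ bx))
  L = proj₁ (proj₂ (proj₂ by))
  x≤A = proj₂ (proj₂ (proj₂ bx))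
  y≤B = proj₂ (proj₂ (proj₂ by))
  scaled = divide-pos (A ℚ.+ B) (ℚ.pos+pos⇒pos A {{A>0}} B {{B>0}}) ε 0<ε
  δ = proj₁ scaled
  0<δ = proj₁ (proj₂ scaled)
  Cδ≡ε = proj₂ (proj₂ scaled)
  M = proj₁ (cx δ 0<δ)
  N = proj₁ (cy δ 0<δ)
  x-x = proj₂ (cx δ 0<δ)
  y-y = proj₂ (cy δ 0<δ)
  KL : ∀ {k} → (K ℕ.⊔ L) ℕ.⊔ (M ℕ.⊔ N) ℕ.≤ k → K ℕ.⊔ L ℕ.≤ k
  KL = ℕ.m⊔n≤o⇒m≤o (K ℕ.⊔ L) (M ℕ.⊔ N)
  MN : ∀ {k} → (K ℕ.⊔ L) ℕ.⊔ (M ℕ.⊔ N) ℕ.≤ k → M ℕ.⊔ N ℕ.≤ k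
  MN = ℕ.m⊔n≤o⇒n≤o (K ℕ.⊔ L) (M ℕ.⊔ N)

_+ᴿ_ : ℝ → ℝ → ℝ
x +ᴿ y = mkℝ (λ i → seq x i ℚ.+ seq y i) (+-cauchy {seq x} {seq y} (cauchy x) (cauchy y))

_*ᴿ_ : ℝ → ℝ → ℝ
x *ᴿ y = mkℝ (λ i → seq x i ℚ.* seq y i) (*-cauchy {seq x} {seq y} (cauchy x) (cauchy y))

isqrt : ℕ → ℕ
isqrt zero = 0
isqrt (suc m) with suc (isqrt m) ℕ.* suc (isqrt m) ℕ.≤? suc m
... | yes _ = suc (isqrt m)
... | no  _ = isqrt m

isqrt-lower : ∀ m → isqrt m ℕ.* isqrt m ℕ.≤ m
isqrt-lower zero = ℕ.z≤n
isqrt-lower (suc m) with suc (isqrt m) ℕ.* suc (isqrt m) ℕ.≤? suc m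
... | yes le = le
... | no  _  = ℕ.m≤n⇒m≤1+n (isqrt-lower m)

isqrt-upper : ∀ m → m ℕ.< suc (isqrt m) ℕ.* suc (isqrt m)
isqrt-upper zero = ℕ.s≤s ℕ.z≤n
isqrt-upper (suc m) with suc (isqrt m) ℕ.* suc (isqrt m) ℕ.≤? suc m
... | yes _  = ℕ.≤-<-trans (isqrt-upper m) (ℕ.*-mono-< (ℕ.n<1+n (suc (isqrt m))) (ℕ.n<1+n (suc (isqrt m))))
... | no ¬le = ℕ.≰⇒> ¬le

root : ℕ → ℕ → ℕ
root m i = isqrt (m ℕ.* (suc i ℕ.* suc i))

approx : ℕ → ℕ → ℚ
approx m i = + root m i / suc i

/-mono-< : ∀ s t j k → s ℕ.* suc k ℕ.< t ℕ.* suc j → + s / suc j ℚ.< + t / suc k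
/-mono-< s t j k lt = ℚ.toℚᵘ-cancel-< (begin-strict
  ℚ.toℚᵘ (+ s / suc j)  ≃⟨ ℚ.toℚᵘ-fromℚᵘ (mkℚᵘ (+ s) j) ⟩
  mkℚᵘ (+ s) j          <⟨ ℚᵘ.*<* (subst₂ ℤ._<_ (ℤ.pos-* s (suc k)) (ℤ.pos-* t (suc j)) (ℤ.+<+ lt)) ⟩
  mkℚᵘ (+ t) k          ≃⟨ ℚ.toℚᵘ-fromℚᵘ (mkℚᵘ (+ t) k) ⟨
  ℚ.toℚᵘ (+ t / suc k)  ∎)
  where open ℚᵘ.≤-Reasoning

/-cross : ∀ s t j k → s ℕ.* suc k ≡ t ℕ.* suc j → + s / suc j ≡ + t / suc k
/-cross s t j k eq = ℚ.fromℚᵘ-cong {mkℚᵘ (+ s) j} {mkℚᵘ (+ t) k}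
  (ℚᵘ.*≡* (subst₂ _≡_ (ℤ.pos-* s (suc k)) (ℤ.pos-* t (suc j)) (cong +_ eq)))

/-homo-+ : ∀ s t j k → + s / suc j ℚ.+ + t / suc k ≡ + (s ℕ.* suc k ℕ.+ t ℕ.* suc j) / (suc j ℕ.* suc k)
/-homo-+ s t j k = ℚ.toℚᵘ-injective (begin-equality
  ℚ.toℚᵘ (+ s / suc j ℚ.+ + t / suc k)
    ≃⟨ ℚ.toℚᵘ-homo-+ (+ s / suc j) (+ t / suc k) ⟩
  ℚ.toℚᵘ (+ s / suc j) ℚᵘ.+ ℚ.toℚᵘ (+ t / suc k)
    ≃⟨ ℚᵘ.+-cong (ℚ.toℚᵘ-fromℚᵘ (mkℚᵘ (+ s) j)) (ℚ.toℚᵘ-fromℚᵘ (mkℚᵘ (+ t) k)) ⟩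
  mkℚᵘ (+ s) j ℚᵘ.+ mkℚᵘ (+ t) k
    ≡⟨ cong (λ h → mkℚᵘ h _) (trans (cong₂ ℤ._+_ (sym (ℤ.pos-* s (suc k))) (sym (ℤ.pos-* t (suc j)))) (sym (ℤ.pos-+ (s ℕ.* suc k) (t ℕ.* suc j)))) ⟩
  mkℚᵘ (+ (s ℕ.* suc k ℕ.+ t ℕ.* suc j)) (k ℕ.+ j ℕ.* suc k)
    ≃⟨ ℚ.toℚᵘ-fromℚᵘ (mkℚᵘ (+ (s ℕ.* suc k ℕ.+ t ℕ.* suc j)) (k ℕ.+ j ℕ.* suc k)) ⟨
  ℚ.toℚᵘ (+ (s ℕ.* suc k ℕ.+ t ℕ.* suc j) / (suc j ℕ.* suc k)) ∎)
  where open ℚᵘ.≤-Reasoning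

/-homo-* : ∀ s t j k → (+ s / suc j) ℚ.* (+ t / suc k) ≡ + (s ℕ.* t) / (suc j ℕ.* suc k)
/-homo-* s t j k = ℚ.toℚᵘ-injective (begin-equality
  ℚ.toℚᵘ ((+ s / suc j) ℚ.* (+ t / suc k))
    ≃⟨ ℚ.toℚᵘ-homo-* (+ s / suc j) (+ t / suc k) ⟩
  ℚ.toℚᵘ (+ s / suc j) ℚᵘ.* ℚ.toℚᵘ (+ t / suc k)
    ≃⟨ ℚᵘ.*-cong (ℚ.toℚᵘ-fromℚᵘ (mkℚᵘ (+ s) j)) (ℚ.toℚᵘ-fromℚᵘ (mkℚᵘ (+ t) k)) ⟩
  mkℚᵘ (+ s) j ℚᵘ.* mkℚᵘ (+ t) k
    ≡⟨ cong (λ h → mkℚᵘ h _) (sym (ℤ.pos-* s t)) ⟩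
  mkℚᵘ (+ (s ℕ.* t)) (k ℕ.+ j ℕ.* suc k)
    ≃⟨ ℚ.toℚᵘ-fromℚᵘ (mkℚᵘ (+ (s ℕ.* t)) (k ℕ.+ j ℕ.* suc k)) ⟨
  ℚ.toℚᵘ (+ (s ℕ.* t) / (suc j ℕ.* suc k)) ∎)
  where open ℚᵘ.≤-Reasoning

small-fraction : ∀ ε → 0ℚ ℚ.< ε → ∀ s k → s ℕ.* ℚ.↧ₙ ε ℕ.< suc k → + s / suc k ℚ.< ε
small-fraction ε@(mkℚ (+ zero) d _) 0<ε s k lt with () ← ℚ.positive 0<ε
small-fraction ε@(mkℚ -[1+ _ ] d _) 0<ε s k lt with () ← ℚ.positive 0<ε
small-fraction ε@(mkℚ (+ suc e) d _) 0<ε s k lt =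
  subst (+ s / suc k ℚ.<_) (ℚ.↥p/↧p≡p ε)
    (/-mono-< s (suc e) k d (ℕ.<-≤-trans lt (ℕ.m≤m+n (suc k) (e ℕ.* suc k))))

square-cancel-< : ∀ {s t} → s ℕ.* s ℕ.< t ℕ.* t → s ℕ.< t
square-cancel-< {s} {t} lt = ℕ.≰⇒> λ t≤s → ℕ.<⇒≱ lt (ℕ.*-mono-≤ t≤s t≤s)

approx-step : ∀ m i j → approx m i ℚ.< approx m j ℚ.+ + 1 / suc j
approx-step m i j = subst (approx m i ℚ.<_) split (/-mono-< s (suc t) i j (square-cancel-< (begin-strict
  s ℕ.* suc j ℕ.* (s ℕ.* suc j)                            ≡⟨ swap s (suc j) ⟩
  s ℕ.* s ℕ.* (suc j ℕ.* suc j)                            ≤⟨ ℕ.*-monoˡ-≤ (suc j ℕ.* suc j) (isqrt-lower (m ℕ.* (suc i ℕ.* suc i))) ⟩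
  m ℕ.* (suc i ℕ.* suc i) ℕ.* (suc j ℕ.* suc j)            ≡⟨ swap′ m (suc i ℕ.* suc i) (suc j ℕ.* suc j) ⟩
  m ℕ.* (suc j ℕ.* suc j) ℕ.* (suc i ℕ.* suc i)            <⟨ ℕ.*-monoˡ-< (suc i ℕ.* suc i) (isqrt-upper (m ℕ.* (suc j ℕ.* suc j))) ⟩
  suc t ℕ.* suc t ℕ.* (suc i ℕ.* suc i)                    ≡⟨ swap (suc t) (suc i) ⟨
  suc t ℕ.* suc i ℕ.* (suc t ℕ.* suc i)                    ∎)))
  where
  open ℕ.≤-Reasoning
  s = root m i
  t = root m j
  swap : ∀ a b → a ℕ.* b ℕ.* (a ℕ.* b) ≡ a ℕ.* a ℕ.* (b ℕ.* b)
  swap = solve-∀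
  swap′ : ∀ a b c → a ℕ.* b ℕ.* c ≡ a ℕ.* c ℕ.* b
  swap′ = solve-∀
  expand : ∀ a b → suc a ℕ.* (b ℕ.* b) ≡ (a ℕ.* b ℕ.+ 1 ℕ.* b) ℕ.* b
  expand = solve-∀
  split : + suc t / suc j ≡ + t / suc j ℚ.+ + 1 / suc j
  split = trans (/-cross (suc t) (t ℕ.* suc j ℕ.+ 1 ℕ.* suc j) j _ (expand t (suc j)))
                (sym (/-homo-+ t 1 j j))

∣-∣-< : ∀ {u v} → u ℚ.< v → ℚ.- u ℚ.< v → ∣ u ∣ ℚ.< v
∣-∣-< {u} {v} u<v -u<v with ℚ.∣p∣≡p∨∣p∣≡-p u
... | inj₁ eq = subst (ℚ._< v) (sym eq) u<v
... | inj₂ eq = subst (ℚ._< v) (sym eq) -u<v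

approx-cauchy : ∀ m → IsCauchy (approx m)
approx-cauchy m ε 0<ε = ℚ.↧ₙ ε , λ i j hi hj →
  ∣-∣-< (gap i j hj) (subst (ℚ._< ε) (flip (approx m j) (approx m i)) (gap j i hi))
  where
  open +-*-Solver
  flip : ∀ u v → u ℚ.- v ≡ ℚ.- (v ℚ.- u)
  flip = solve 2 (λ u v → u :+ (:- v) := :- (v :+ (:- u))) refl
  cancel : ∀ u v → u ℚ.+ v ℚ.- u ≡ v
  cancel = solve 2 (λ u v → u :+ v :+ (:- u) := v) refl
  gap : ∀ i j → ℚ.↧ₙ ε ℕ.≤ j → approx m i ℚ.- approx m j ℚ.< ε
  gap i j hj = begin-strict
    approx m i ℚ.- approx m j                       <⟨ ℚ.+-monoˡ-< (ℚ.- approx m j) (approx-step m i j) ⟩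
    approx m j ℚ.+ + 1 / suc j ℚ.- approx m j       ≡⟨ cancel (approx m j) (+ 1 / suc j) ⟩
    + 1 / suc j                                     <⟨ small-fraction ε 0<ε 1 j (ℕ.s≤s (ℕ.≤-trans (ℕ.≤-reflexive (ℕ.*-identityˡ _)) hj)) ⟩
    ε                                               ∎
    where open ℚ.≤-Reasoning

-- The limit of the nonnegative rationals ⌊√(m(i+1)²)⌋ / (i+1).
√ : ℕ → ℝ
√ m = mkℝ (approx m) (approx-cauchy m)

√-nonneg : ∀ m i → 0ℚ ℚ.≤ seq (√ m) i
√-nonneg m i = ℚ.nonNegative⁻¹ (approx m i) {{ℚ.normalize-nonNeg (root m i) (suc i)}}

√-square : ∀ m → √ m *ᴿ √ m ≃ fromℕ m
√-square m ε 0<ε = 2 ℕ.* m ℕ.* ℚ.↧ₙ ε , close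
  where
  module _ (i : ℕ) (hi : 2 ℕ.* m ℕ.* ℚ.↧ₙ ε ℕ.≤ i) where
    K = suc i
    s = root m i
    r = m ℕ.* (K ℕ.* K) ℕ.∸ s ℕ.* s

    s²+r : s ℕ.* s ℕ.+ r ≡ m ℕ.* (K ℕ.* K)
    s²+r = ℕ.m+[n∸m]≡n (isqrt-lower (m ℕ.* (K ℕ.* K)))

    r≤2s : r ℕ.≤ 2 ℕ.* s
    r≤2s = ℕ.+-cancelˡ-≤ (s ℕ.* s) r (2 ℕ.* s) (ℕ.≤-pred (begin-strict
      s ℕ.* s ℕ.+ r               ≡⟨ s²+r ⟩
      m ℕ.* (K ℕ.* K)             <⟨ isqrt-upper (m ℕ.* (K ℕ.* K)) ⟩
      suc s ℕ.* suc s             ≡⟨ expand s ⟩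
      suc (s ℕ.* s ℕ.+ 2 ℕ.* s)   ∎))
      where
      open ℕ.≤-Reasoning
      expand : ∀ a → suc a ℕ.* suc a ≡ suc (a ℕ.* a ℕ.+ 2 ℕ.* a)
      expand = solve-∀

    s≤mK : s ℕ.≤ m ℕ.* K
    s≤mK = ℕ.≮⇒≥ λ mK<s → ℕ.<⇒≱ (ℕ.*-mono-< mK<s mK<s)
      (ℕ.≤-trans (isqrt-lower (m ℕ.* (K ℕ.* K))) (grow m))
      where
      regroup : ∀ a b → a ℕ.* a ℕ.* (b ℕ.* b) ≡ a ℕ.* b ℕ.* (a ℕ.* b)
      regroup = solve-∀
      grow : ∀ a → a ℕ.* (K ℕ.* K) ℕ.≤ a ℕ.* K ℕ.* (a ℕ.* K)
      grow zero    = ℕ.z≤n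
      grow (suc a) = ℕ.≤-trans (ℕ.*-monoˡ-≤ (K ℕ.* K) (ℕ.m≤m+n (suc a) (a ℕ.* suc a)))
                               (ℕ.≤-reflexive (regroup (suc a) K))

    r-small : r ℕ.* ℚ.↧ₙ ε ℕ.< K ℕ.* K
    r-small = begin-strict
      r ℕ.* D                      ≤⟨ ℕ.*-monoˡ-≤ D (ℕ.≤-trans r≤2s (ℕ.*-monoʳ-≤ 2 s≤mK)) ⟩
      2 ℕ.* (m ℕ.* K) ℕ.* D        ≡⟨ regroup m K D ⟩
      2 ℕ.* m ℕ.* D ℕ.* K          <⟨ ℕ.*-monoˡ-< K (ℕ.s≤s hi) ⟩
      K ℕ.* K                      ∎
      where
      open ℕ.≤-Reasoning
      D = ℚ.↧ₙ ε
      regroup : ∀ a b c → 2 ℕ.* (a ℕ.* b) ℕ.* c ≡ 2 ℕ.* a ℕ.* c ℕ.* b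
      regroup = solve-∀

    open +-*-Solver
    difference : ∀ u v → u ℚ.- (u ℚ.+ v) ≡ ℚ.- v
    difference = solve 2 (λ u v → u :+ (:- (u :+ v)) := :- v) refl

    m-split : + m / 1 ≡ (+ s / K) ℚ.* (+ s / K) ℚ.+ + r / (K ℕ.* K)
    m-split = sym (trans (cong (ℚ._+ (+ r / (K ℕ.* K))) (/-homo-* s s i i))
             (trans (/-homo-+ (s ℕ.* s) r _ _) (/-cross (s ℕ.* s ℕ.* (K ℕ.* K) ℕ.+ r ℕ.* (K ℕ.* K)) m _ 0 (trans (ℕ.*-identityʳ (s ℕ.* s ℕ.* (K ℕ.* K) ℕ.+ r ℕ.* (K ℕ.* K)))
               (trans (sym (ℕ.*-distribʳ-+ (K ℕ.* K) (s ℕ.* s) r)) (trans (cong (ℕ._* (K ℕ.* K)) s²+r) (ℕ.*-assoc m (K ℕ.* K) (K ℕ.* K))))))))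

    close : ∣ (+ s / K) ℚ.* (+ s / K) ℚ.- + m / 1 ∣ ℚ.< ε
    close = begin-strict
      ∣ (+ s / K) ℚ.* (+ s / K) ℚ.- + m / 1 ∣    ≡⟨ cong (λ h → ∣ (+ s / K) ℚ.* (+ s / K) ℚ.- h ∣) m-split ⟩
      ∣ (+ s / K) ℚ.* (+ s / K) ℚ.- ((+ s / K) ℚ.* (+ s / K) ℚ.+ + r / (K ℕ.* K)) ∣
                                                 ≡⟨ cong ∣_∣ (difference ((+ s / K) ℚ.* (+ s / K)) (+ r / (K ℕ.* K))) ⟩
      ∣ ℚ.- (+ r / (K ℕ.* K)) ∣                  ≡⟨ ℚ.∣-p∣≡∣p∣ (+ r / (K ℕ.* K)) ⟩
      ∣ + r / (K ℕ.* K) ∣                        ≡⟨ ℚ.0≤p⇒∣p∣≡p (ℚ.nonNegative⁻¹ (+ r / (K ℕ.* K)) {{ℚ.normalize-nonNeg r (K ℕ.* K)}}) ⟩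
      + r / (K ℕ.* K)                            <⟨ small-fraction ε 0<ε r _ r-small ⟩
      ε                                          ∎
      where open ℚ.≤-Reasoning

record SimpleGraph (V : Set a) ℓ : Set (a ⊔ L.suc ℓ) where
  field
    Adj        : Rel V ℓ
    adj-sym    : Symmetric Adj
    adj-irrefl : ∀ {v} → ¬ Adj v v

open SimpleGraph public

module _ (G : SimpleGraph (Fin n) ℓ) (adj? : Decidable (Adj G)) where

  degree : Fin n → ℕ
  degree v = length (filter (adj? v) (allFin n))

  -- An unordered edge {u, v} is listed once, as the pair (u , v) with u < v.
  edges : List (Fin n × Fin n)
  edges = filter (λ (u , v) → (u Fin.<? v) ×-dec adj? u v)
                 (cartesianProduct (allFin n) (allFin n))

  SO : ℝ
  SO = foldr _+ᴿ_ 0ᴿ (map (λ (u , v) → √ (degree u ℕ.^ 2 ℕ.+ degree v ℕ.^ 2)) edges)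

module _ (R : CommutativeRing c ℓ) where
  open CommutativeRing R using (Carrier; _≈_; 0#; _+_; _*_; +-comm; *-cong) renaming (refl to ≈-refl; sym to ≈-sym; trans to ≈-trans)

  -- 0 is included by fiat, so that it belongs to Z even in the zero ring.
  Z : U.Pred Carrier (c ⊔ ℓ)
  Z x = x ≈ 0# ⊎ ∃[ y ] (¬ y ≈ 0#) × x * y ≈ 0#

  T-Γ : SimpleGraph Carrier (c ⊔ ℓ)
  T-Γ = record
    { Adj        = λ x y → (¬ x ≈ y) × Z (x + y)
    ; adj-sym    = λ {x} {y} (x≉y , z) → (λ y≈x → x≉y (≈-sym y≈x)) , Z-resp (+-comm x y) z
    ; adj-irrefl = λ (x≉x , _) → x≉x ≈-refl
    }
    where
    Z-resp : ∀ {x y} → x ≈ y → Z x → Z y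
    Z-resp x≈y (inj₁ x≈0)            = inj₁ (≈-trans (≈-sym x≈y) x≈0)
    Z-resp x≈y (inj₂ (w , w≉0 , xw)) = inj₂ (w , w≉0 , ≈-trans (*-cong (≈-sym x≈y) ≈-refl) xw)

module _ (n : ℕ) .{{_ : NonZero n}} where

  infixl 6 _⊕_
  infixl 7 _⊗_

  _⊕_ _⊗_ : Fin n → Fin n → Fin n
  x ⊕ y = (toℕ x ℕ.+ toℕ y) mod n
  x ⊗ y = (toℕ x ℕ.* toℕ y) mod n

  ⊖_ : Fin n → Fin n
  ⊖ x = (n ℕ.∸ toℕ x) mod n

  toℕ-mod : ∀ m → toℕ (m mod n) ≡ m % n
  toℕ-mod m = Fin.toℕ-fromℕ< (m%n<n m n)

  mod-cong : ∀ {l m} → l % n ≡ m % n → l mod n ≡ m mod n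
  mod-cong {l} {m} eq = Fin.toℕ-injective (trans (toℕ-mod l) (trans eq (sym (toℕ-mod m))))

  mod-toℕ : ∀ x → toℕ x mod n ≡ x
  mod-toℕ x = Fin.toℕ-injective (trans (toℕ-mod (toℕ x)) (m<n⇒m%n≡m (Fin.toℕ<n x)))

  mod-⊕ : ∀ l m → (l mod n) ⊕ (m mod n) ≡ (l ℕ.+ m) mod n
  mod-⊕ l m rewrite toℕ-mod l | toℕ-mod m = mod-cong (sym (%-distribˡ-+ l m n))

  mod-⊗ : ∀ l m → (l mod n) ⊗ (m mod n) ≡ (l ℕ.* m) mod n
  mod-⊗ l m rewrite toℕ-mod l | toℕ-mod m = mod-cong (sym (%-distribˡ-* l m n))

  mod-⊕ˡ : ∀ l y → (l mod n) ⊕ y ≡ (l ℕ.+ toℕ y) mod n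
  mod-⊕ˡ l y = trans (cong ((l mod n) ⊕_) (sym (mod-toℕ y))) (mod-⊕ l (toℕ y))

  mod-⊗ˡ : ∀ l y → (l mod n) ⊗ y ≡ (l ℕ.* toℕ y) mod n
  mod-⊗ˡ l y = trans (cong ((l mod n) ⊗_) (sym (mod-toℕ y))) (mod-⊗ l (toℕ y))

  ⊕-comm : ∀ x y → x ⊕ y ≡ y ⊕ x
  ⊕-comm x y = cong (_mod n) (ℕ.+-comm (toℕ x) (toℕ y))

  ⊗-comm : ∀ x y → x ⊗ y ≡ y ⊗ x
  ⊗-comm x y = cong (_mod n) (ℕ.*-comm (toℕ x) (toℕ y))

  ⊕-assoc : ∀ x y z → (x ⊕ y) ⊕ z ≡ x ⊕ (y ⊕ z)
  ⊕-assoc x y z = trans (mod-⊕ˡ _ z) (trans (cong (_mod n) (ℕ.+-assoc (toℕ x) (toℕ y) (toℕ z)))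
    (trans (cong (_mod n) (ℕ.+-comm (toℕ x) _)) (trans (sym (mod-⊕ˡ _ x)) (⊕-comm (y ⊕ z) x))))

  ⊗-assoc : ∀ x y z → (x ⊗ y) ⊗ z ≡ x ⊗ (y ⊗ z)
  ⊗-assoc x y z = trans (mod-⊗ˡ _ z) (trans (cong (_mod n) (ℕ.*-assoc (toℕ x) (toℕ y) (toℕ z)))
    (trans (cong (_mod n) (ℕ.*-comm (toℕ x) _)) (trans (sym (mod-⊗ˡ _ x)) (⊗-comm (y ⊗ z) x))))

  ⊕-identityˡ : ∀ x → (0 mod n) ⊕ x ≡ x
  ⊕-identityˡ x = trans (mod-⊕ˡ 0 x) (mod-toℕ x)

  ⊗-identityˡ : ∀ x → (1 mod n) ⊗ x ≡ x
  ⊗-identityˡ x = trans (mod-⊗ˡ 1 x) (trans (cong (_mod n) (ℕ.*-identityˡ (toℕ x))) (mod-toℕ x))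

  ⊖-inverseˡ : ∀ x → (⊖ x) ⊕ x ≡ 0 mod n
  ⊖-inverseˡ x = trans (mod-⊕ˡ _ x) (mod-cong
    (trans (cong (_% n) (ℕ.m∸n+n≡m (ℕ.<⇒≤ (Fin.toℕ<n x))))
      (trans (n%n≡0 n) (sym (m<n⇒m%n≡m (ℕ.>-nonZero⁻¹ n))))))

  ⊗-distribʳ-⊕ : ∀ x y z → (y ⊕ z) ⊗ x ≡ (y ⊗ x) ⊕ (z ⊗ x)
  ⊗-distribʳ-⊕ x y z = trans (mod-⊗ˡ _ x)
    (trans (cong (_mod n) (ℕ.*-distribʳ-+ (toℕ x) (toℕ y) (toℕ z))) (sym (mod-⊕ _ _)))

  ⊗-distribˡ-⊕ : ∀ x y z → x ⊗ (y ⊕ z) ≡ (x ⊗ y) ⊕ (x ⊗ z)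
  ⊗-distribˡ-⊕ x y z = trans (⊗-comm x (y ⊕ z)) (trans (⊗-distribʳ-⊕ x y z) (cong₂ _⊕_ (⊗-comm y x) (⊗-comm z x)))

  ℤ/ : CommutativeRing 0ℓ 0ℓ
  ℤ/ = record
    { Carrier = Fin n
    ; _≈_     = _≡_
    ; _+_     = _⊕_
    ; _*_     = _⊗_
    ; -_      = ⊖_
    ; 0#      = 0 mod n
    ; 1#      = 1 mod n
    ; isCommutativeRing = record
      { isRing = record
        { +-isAbelianGroup = record
          { isGroup = record
            { isMonoid = record
              { isSemigroup = record
                { isMagma = record { isEquivalence = isEquivalence ; ∙-cong = cong₂ _⊕_ }
                ; assoc   = ⊕-assoc
                }
              ; identity = ⊕-identityˡ , λ x → trans (⊕-comm x (0 mod n)) (⊕-identityˡ x)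
              }
            ; inverse = ⊖-inverseˡ , λ x → trans (⊕-comm x (⊖ x)) (⊖-inverseˡ x)
            ; ⁻¹-cong = cong ⊖_
            }
          ; comm = ⊕-comm
          }
        ; *-cong     = cong₂ _⊗_
        ; *-assoc    = ⊗-assoc
        ; *-identity = ⊗-identityˡ , λ x → trans (⊗-comm x (1 mod n)) (⊗-identityˡ x)
        ; distrib    = ⊗-distribˡ-⊕ , ⊗-distribʳ-⊕
        }
      ; *-comm = ⊗-comm
      }
    }

  Z? : U.Decidable (Z ℤ/)
  Z? x = (x Fin.≟ (0 mod n)) ⊎-dec Fin.any? λ y → ¬? (y Fin.≟ (0 mod n)) ×-dec ((x ⊗ y) Fin.≟ (0 mod n))

  T-Γ-adj? : Decidable (Adj (T-Γ ℤ/))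
  T-Γ-adj? x y = ¬? (x Fin.≟ y) ×-dec Z? (x ⊕ y)

φ : ℕ → ℕ
φ n = length (filter (λ k → coprime? k n) (map suc (upTo n)))

{-# OPTIONS --safe #-}
module Submission where

-- Put z u = 1 if u lies in Z and z u = 0 otherwise, and let w be the number of zero-divisors, so that
-- w = n - φ(n) = p + q - 1.  As 2 is a unit, u + u ∈ Z iff u ∈ Z, so deg u = w - z u, and an edge has
-- one of three weights, according to how many of its ends lie in Z.  With a, b, c the numbers of edges
-- with two, one and no end in Z, double counting [u + v ∈ Z] against z u · z v, z u + z v and 1 gives
--   2a + w = p² + q² - 1,   2a + b + w = w²,   2(a + b + c) + w = n w,
-- where the first uses that u, v, u + v ∈ Z forces p or q to divide both u and v.

open import Defs
open import Data.Bool.Base using (true; false; if_then_else_)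
open import Data.Fin.Base using (Fin; zero; suc; toℕ)
import Data.Fin.Properties as Fin
open import Data.Integer.Base using (+_)
open import Data.List.Base using (List; []; _∷_; map; filter; foldr; length; tabulate; allFin; upTo; applyUpTo; cartesianProduct)
open import Data.List.Properties using (map-∘; map-++; map-cong)
open import Data.Nat.Base as ℕ using (ℕ; zero; suc; NonZero; _+_; _*_; _∸_; _^_; _<_; _≤_; _⊔_; s≤s)
open import Data.Nat.Coprimality using (Coprime; coprime?; coprime-divisor)
open import Data.Nat.Divisibility
open import Data.Nat.DivMod using (_mod_)
open import Data.Nat.ListAction using () renaming (sum to sumˡ)
open import Data.Nat.ListAction.Properties using (sum-++)
open import Data.Nat.Primality using (Prime; euclidsLemma; prime⇒nonZero; prime⇒nonTrivial; prime⇒irreducible; prime[2]; ¬prime[1])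
import Data.Nat.Properties as ℕ
open import Data.Nat.Tactic.RingSolver using (solve-∀)
open import Data.Product using (_×_; _,_; proj₁; proj₂)
open import Data.Rational.Base as ℚ using (ℚ; 0ℚ; 1ℚ; _/_; _-_)
import Data.Rational.Properties as ℚ
open import Data.Rational.Solver using (module +-*-Solver)
open import Data.Sum.Base using (_⊎_; inj₁; inj₂)
open import Function.Base using (_∘_; id)
open import Function.Bundles using (mk⇔)
open import Relation.Binary.Definitions using (Decidable; tri<; tri≈; tri>)
open import Relation.Binary.PropositionalEquality
open import Relation.Nullary using (¬_; Dec; yes; no; does; contradiction)
open import Relation.Nullary.Decidable using (¬?; _×-dec_; _⊎-dec_; does-⇔; dec-true; dec-false)
import Relation.Unary as U

open import Algebra.Properties.Semiring.Sum ℕ.+-*-semiring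
  using (sum; sum-cong-≗; ∑-comm; ∑-distrib-+; *-distribˡ-sum)

-- Real numbers

-- The obstacle on the real side is that `≃` compares limits: the approximants of
-- `√ (d ^ 2 + d ^ 2)` and of `√ 2 *ᴿ fromℕ d` differ in general, since rounding down does not
-- commute with multiplication by `d`. That identity alone needs an ε-argument of its own; sorting
-- the edges by weight is done termwise, at each index of the Cauchy sequences. On the counting
-- side, the sums `u + v` for fixed `u` run through a window of `pq` consecutive integers, and by
-- periodicity every such window contains equally many multiples of `p` or `q`. Hence each row of
-- `[u + v ∈ Z]` sums to the same `w`, which is where `w²` and `n w` come from. Since `∸` truncates,
-- corrections are kept as terms added to the other side.

≗⇒≃ : ∀ x y → seq x ≗ seq y → x ≃ y
≗⇒≃ x y eq ε 0<ε = 0 , λ i _ → subst (λ r → ℚ.∣ seq x i - r ∣ ℚ.< ε) (eq i)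
  (subst (ℚ._< ε) (cong ℚ.∣_∣ (sym (ℚ.+-inverseʳ (seq x i)))) 0<ε)

≃-trans : ∀ x y z → x ≃ y → y ≃ z → x ≃ z
≃-trans x y z x≃y y≃z ε 0<ε with x≃y _ (half-pos 0<ε) | y≃z _ (half-pos 0<ε)
... | M , xy | N , yz = M ⊔ N , λ i hi → let open ℚ.≤-Reasoning in begin-strict
  ℚ.∣ seq x i - seq z i ∣
    ≡⟨ cong ℚ.∣_∣ (split (seq x i) (seq y i) (seq z i)) ⟩
  ℚ.∣ (seq x i - seq y i) ℚ.+ (seq y i - seq z i) ∣
    ≤⟨ ℚ.∣p+q∣≤∣p∣+∣q∣ (seq x i - seq y i) (seq y i - seq z i) ⟩
  ℚ.∣ seq x i - seq y i ∣ ℚ.+ ℚ.∣ seq y i - seq z i ∣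
    <⟨ ℚ.+-mono-< (xy i (ℕ.m⊔n≤o⇒m≤o M N hi)) (yz i (ℕ.m⊔n≤o⇒n≤o M N hi)) ⟩
  ℚ.½ ℚ.* ε ℚ.+ ℚ.½ ℚ.* ε
    ≡⟨ half+half ε ⟩
  ε ∎
  where
  open +-*-Solver
  split : ∀ a b c → a - c ≡ (a - b) ℚ.+ (b - c)
  split = solve 3 (λ a b c → a :+ (:- c) := (a :+ (:- b)) :+ (b :+ (:- c))) refl

+ᴿ-cong : ∀ x x′ y y′ → x ≃ x′ → y ≃ y′ → x +ᴿ y ≃ x′ +ᴿ y′
+ᴿ-cong x x′ y y′ x≃x′ y≃y′ ε 0<ε with x≃x′ _ (half-pos 0<ε) | y≃y′ _ (half-pos 0<ε)
... | M , xx | N , yy = M ⊔ N , λ i hi → let open ℚ.≤-Reasoning in begin-strict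
  ℚ.∣ (seq x i ℚ.+ seq y i) - (seq x′ i ℚ.+ seq y′ i) ∣
    ≡⟨ cong ℚ.∣_∣ (regroup (seq x i) (seq y i) (seq x′ i) (seq y′ i)) ⟩
  ℚ.∣ (seq x i - seq x′ i) ℚ.+ (seq y i - seq y′ i) ∣
    ≤⟨ ℚ.∣p+q∣≤∣p∣+∣q∣ (seq x i - seq x′ i) (seq y i - seq y′ i) ⟩
  ℚ.∣ seq x i - seq x′ i ∣ ℚ.+ ℚ.∣ seq y i - seq y′ i ∣
    <⟨ ℚ.+-mono-< (xx i (ℕ.m⊔n≤o⇒m≤o M N hi)) (yy i (ℕ.m⊔n≤o⇒n≤o M N hi)) ⟩
  ℚ.½ ℚ.* ε ℚ.+ ℚ.½ ℚ.* ε
    ≡⟨ half+half ε ⟩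
  ε ∎
  where
  open +-*-Solver
  regroup : ∀ a b c d → (a ℚ.+ b) - (c ℚ.+ d) ≡ (a - c) ℚ.+ (b - d)
  regroup = solve 4 (λ a b c d → (a :+ b) :+ (:- (c :+ d)) := (a :+ (:- c)) :+ (b :+ (:- d))) refl

*ᴿ-congˡ : ∀ r x y → x ≃ y → fromℚ r *ᴿ x ≃ fromℚ r *ᴿ y
-- The added 1 keeps the divisor of ε positive even for `r = 0`.
*ᴿ-congˡ r x y x≃y ε 0<ε with divide-pos (ℚ.∣ r ∣ ℚ.+ 1ℚ) (ℚ.nonNeg+pos⇒pos ℚ.∣ r ∣ {{ℚ.∣-∣-nonNeg r}} 1ℚ) ε 0<ε
... | δ , 0<δ , Cδ≡ε with x≃y δ 0<δ
... | N , xy = N , λ i hi → let open ℚ.≤-Reasoning in begin-strict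
  ℚ.∣ r ℚ.* seq x i - r ℚ.* seq y i ∣
    ≡⟨ cong ℚ.∣_∣ (factor r (seq x i) (seq y i)) ⟩
  ℚ.∣ r ℚ.* (seq x i - seq y i) ∣
    <⟨ ∣*∣-mono-< {ℚ.∣ r ∣ ℚ.+ 1ℚ} {δ} r (seq x i - seq y i)
         (ℚ.nonNeg+pos⇒pos ℚ.∣ r ∣ {{ℚ.∣-∣-nonNeg r}} 1ℚ) ∣r∣≤ (xy i hi) ⟩
  (ℚ.∣ r ∣ ℚ.+ 1ℚ) ℚ.* δ
    ≡⟨ Cδ≡ε ⟩
  ε ∎
  where
  open +-*-Solver
  factor : ∀ a b c → a ℚ.* b - a ℚ.* c ≡ a ℚ.* (b - c)
  factor = solve 3 (λ a b c → a :* b :+ (:- (a :* c)) := a :* (b :+ (:- c))) refl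
  ∣r∣≤ : ℚ.∣ r ∣ ℚ.≤ ℚ.∣ r ∣ ℚ.+ 1ℚ
  ∣r∣≤ = subst (ℚ._≤ ℚ.∣ r ∣ ℚ.+ 1ℚ) (ℚ.+-identityʳ ℚ.∣ r ∣) (ℚ.+-monoʳ-≤ ℚ.∣ r ∣ (ℚ.nonNegative⁻¹ 1ℚ))

square-cancel-≤ : ∀ {s t} → s * s ≤ t * t → s ≤ t
square-cancel-≤ le = ℕ.≮⇒≥ λ t<s → ℕ.<⇒≱ (ℕ.*-mono-< t<s t<s) le

-- With `K = suc i`, `s = ⌊√2 K⌋` and `t = ⌊a √2 K⌋`, comparing squares gives `s a ≤ t ≤ (s + 1) a`.
-- So the terms differ by at most `a / K`, which is below ε once `K` exceeds `a` times the
-- denominator of ε.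
√-double-square : ∀ a → √ (a ^ 2 + a ^ 2) ≃ √ 2 *ᴿ fromℕ a
√-double-square a ε 0<ε = a * ℚ.↧ₙ ε , close
  where
  module _ (i : ℕ) (hi : a * ℚ.↧ₙ ε ≤ i) where
    K = suc i
    s = root 2 i
    t = root (a ^ 2 + a ^ 2) i
    r = t ∸ s * a

    -- a * (a * 1) is a ^ 2 unfolded: the ring solver does not see through _^_.
    regroup : ∀ a k → (a * (a * 1) + a * (a * 1)) * (k * k) ≡ 2 * (k * k) * (a * a)
    regroup = solve-∀
    swap : ∀ a b → a * b * (a * b) ≡ a * a * (b * b)
    swap = solve-∀

    sa≤t : s * a ≤ t
    sa≤t = ℕ.≤-pred (square-cancel-< (begin-strict
      s * a * (s * a)               ≡⟨ swap s a ⟩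
      s * s * (a * a)               ≤⟨ ℕ.*-monoˡ-≤ (a * a) (isqrt-lower (2 * (K * K))) ⟩
      2 * (K * K) * (a * a)         ≡⟨ regroup a K ⟨
      (a ^ 2 + a ^ 2) * (K * K)     <⟨ isqrt-upper ((a ^ 2 + a ^ 2) * (K * K)) ⟩
      suc t * suc t                 ∎))
      where open ℕ.≤-Reasoning

    t≤sa+a : t ≤ suc s * a
    t≤sa+a = square-cancel-≤ (begin
      t * t                         ≤⟨ isqrt-lower ((a ^ 2 + a ^ 2) * (K * K)) ⟩
      (a ^ 2 + a ^ 2) * (K * K)     ≡⟨ regroup a K ⟩
      2 * (K * K) * (a * a)         ≤⟨ ℕ.*-monoˡ-≤ (a * a) (ℕ.<⇒≤ (isqrt-upper (2 * (K * K)))) ⟩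
      suc s * suc s * (a * a)       ≡⟨ swap (suc s) a ⟨
      suc s * a * (suc s * a)       ∎)
      where open ℕ.≤-Reasoning

    r≤a : r ≤ a
    r≤a = subst (r ≤_) (ℕ.m+n∸n≡m a (s * a)) (ℕ.∸-monoˡ-≤ (s * a) t≤sa+a)

    open +-*-Solver
    difference : ∀ u v → (u ℚ.+ v) - u ≡ v
    difference = solve 2 (λ u v → (u :+ v) :+ (:- u) := v) refl

    expand : ∀ k u v → (u + v) * (k * k) ≡ (u * k + v * k) * k
    expand = solve-∀

    t-split : + t / K ≡ + (s * a) / K ℚ.+ + r / K
    t-split = trans (/-cross t (s * a * K + r * K) i _
        (trans (cong (_* (K * K)) (sym (ℕ.m+[n∸m]≡n sa≤t))) (expand K (s * a) r)))
      (sym (/-homo-+ (s * a) r i i))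

    sa-split : (+ s / K) ℚ.* (+ a / 1) ≡ + (s * a) / K
    sa-split = trans (/-homo-* s a i 0) (/-cross (s * a) (s * a) _ i (cong (s * a *_) (sym (ℕ.*-identityʳ K))))

    close : ℚ.∣ + t / K - (+ s / K) ℚ.* (+ a / 1) ∣ ℚ.< ε
    close = begin-strict
      ℚ.∣ + t / K - (+ s / K) ℚ.* (+ a / 1) ∣
        ≡⟨ cong₂ (λ u v → ℚ.∣ u - v ∣) t-split sa-split ⟩
      ℚ.∣ (+ (s * a) / K ℚ.+ + r / K) - + (s * a) / K ∣
        ≡⟨ cong ℚ.∣_∣ (difference (+ (s * a) / K) (+ r / K)) ⟩
      ℚ.∣ + r / K ∣
        ≡⟨ ℚ.0≤p⇒∣p∣≡p (ℚ.nonNegative⁻¹ (+ r / K) {{ℚ.normalize-nonNeg r K}}) ⟩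
      + r / K
        <⟨ small-fraction ε 0<ε r i (ℕ.s≤s (ℕ.≤-trans (ℕ.*-monoˡ-≤ (ℚ.↧ₙ ε) r≤a) hi)) ⟩
      ε ∎
      where open ℚ.≤-Reasoning

/1-homo-+ : ∀ a b → + (a + b) / 1 ≡ + a / 1 ℚ.+ + b / 1
/1-homo-+ a b = sym (trans (/-homo-+ a b 0 0)
  (cong₂ (λ m n → + (m + n) / 1) (ℕ.*-identityʳ a) (ℕ.*-identityʳ b)))

-- Turns the halves in `α` and `E` of the theorem into whole numbers of edges.
half-double : ∀ {k m} → 2 * k ≡ m → + m / 2 ≡ + k / 1
half-double {k} {m} eq = /-cross m k 1 0 (trans (ℕ.*-identityʳ m) (trans (sym eq) (ℕ.*-comm 2 k)))

combination : ℚ → ℚ → ℚ → ℕ → ℕ → ℕ → ℚ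
combination X Y W a b c = X ℚ.* (+ a / 1) ℚ.+ Y ℚ.* (+ b / 1) ℚ.+ W ℚ.* (+ c / 1)

combination-+ : ∀ X Y W a b c a′ b′ c′ → combination X Y W a b c ℚ.+ combination X Y W a′ b′ c′
                                        ≡ combination X Y W (a + a′) (b + b′) (c + c′)
combination-+ X Y W a b c a′ b′ c′ rewrite /1-homo-+ a a′ | /1-homo-+ b b′ | /1-homo-+ c c′ =
  regroup X Y W (+ a / 1) (+ b / 1) (+ c / 1) (+ a′ / 1) (+ b′ / 1) (+ c′ / 1)
  where
  open +-*-Solver
  regroup : ∀ X Y W a b c a′ b′ c′ →
    (X ℚ.* a ℚ.+ Y ℚ.* b ℚ.+ W ℚ.* c) ℚ.+ (X ℚ.* a′ ℚ.+ Y ℚ.* b′ ℚ.+ W ℚ.* c′) ≡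
    X ℚ.* (a ℚ.+ a′) ℚ.+ Y ℚ.* (b ℚ.+ b′) ℚ.+ W ℚ.* (c ℚ.+ c′)
  regroup = solve 9 (λ X Y W a b c a′ b′ c′ →
    (X :* a :+ Y :* b :+ W :* c) :+ (X :* a′ :+ Y :* b′ :+ W :* c′) :=
    X :* (a :+ a′) :+ Y :* (b :+ b′) :+ W :* (c :+ c′)) refl

-- Addition of reals is addition of terms, so the sum over a list can be sorted into three weights
-- at each index separately, with no ε.
foldr-combination : ∀ {A : Set} (t : A → ℝ) (X Y W : ℝ) (a b c : A → ℕ) →
  (∀ e i → seq (t e) i ≡ combination (seq X i) (seq Y i) (seq W i) (a e) (b e) (c e)) →
  ∀ es i → seq (foldr _+ᴿ_ 0ᴿ (map t es)) i ≡
           combination (seq X i) (seq Y i) (seq W i) (sumˡ (map a es)) (sumˡ (map b es)) (sumˡ (map c es))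
foldr-combination t X Y W a b c eq [] i = solve 3 (λ X Y W → con 0ℚ := X :* con 0ℚ :+ Y :* con 0ℚ :+ W :* con 0ℚ) refl (seq X i) (seq Y i) (seq W i)
  where open +-*-Solver
foldr-combination t X Y W a b c eq (e ∷ es) i =
  trans (cong₂ ℚ._+_ (eq e i) (foldr-combination t X Y W a b c eq es i))
        (combination-+ (seq X i) (seq Y i) (seq W i) (a e) (b e) (c e) _ _ _)

module _ (X Y W : ℚ) where

  open +-*-Solver

  combination-100 : X ≡ combination X Y W 1 0 0
  combination-100 = solve 3 (λ X Y W → X := X :* con 1ℚ :+ Y :* con 0ℚ :+ W :* con 0ℚ) refl X Y W

  combination-010 : Y ≡ combination X Y W 0 1 0
  combination-010 = solve 3 (λ X Y W → Y := X :* con 0ℚ :+ Y :* con 1ℚ :+ W :* con 0ℚ) refl X Y W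

  combination-001 : W ≡ combination X Y W 0 0 1
  combination-001 = solve 3 (λ X Y W → W := X :* con 0ℚ :+ Y :* con 0ℚ :+ W :* con 1ℚ) refl X Y W

-- Indicators and finite sums

ind : ∀ {a} {P : Set a} → Dec P → ℕ
ind P? = if does P? then 1 else 0

module _ {a b} {P : Set a} {Q : Set b} (P? : Dec P) (Q? : Dec Q) where

  ind-⇔ : (P → Q) → (Q → P) → ind P? ≡ ind Q?
  ind-⇔ to from = cong (if_then 1 else 0) (does-⇔ (mk⇔ to from) P? Q?)

  ind-× : ind (P? ×-dec Q?) ≡ ind P? * ind Q?
  ind-× with does P? | does Q?
  ... | true  | true  = refl
  ... | true  | false = refl
  ... | false | _     = refl

  -- Inclusion-exclusion, with the overlap added on the left to avoid subtraction.
  ind-⊎ : ind (P? ⊎-dec Q?) + ind P? * ind Q? ≡ ind P? + ind Q?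
  ind-⊎ with does P? | does Q?
  ... | true  | true  = refl
  ... | true  | false = refl
  ... | false | true  = refl
  ... | false | false = refl

module _ {a} {P : Set a} (P? : Dec P) where

  ind-true : P → ind P? ≡ 1
  ind-true p = cong (if_then 1 else 0) (dec-true P? p)

  ind-false : ¬ P → ind P? ≡ 0
  ind-false ¬p = cong (if_then 1 else 0) (dec-false P? ¬p)

  ind-¬ : ind (¬? P?) + ind P? ≡ 1
  ind-¬ with does P?
  ... | true  = refl
  ... | false = refl

  ind-idem : ind P? * ind P? ≡ ind P?
  ind-idem with does P?
  ... | true  = refl
  ... | false = refl

  ind-bit : ind P? ≡ 0 ⊎ ind P? ≡ 1
  ind-bit with does P?
  ... | true  = inj₂ refl
  ... | false = inj₁ refl

module _ {A : Set} where

  sum-map-filter : ∀ {ℓ} {P : U.Pred A ℓ} (P? : U.Decidable P) (f : A → ℕ) xs →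
                   sumˡ (map f (filter P? xs)) ≡ sumˡ (map (λ x → ind (P? x) * f x) xs)
  sum-map-filter P? f []       = refl
  sum-map-filter P? f (x ∷ xs) with does (P? x)
  ... | true  = cong₂ _+_ (sym (ℕ.+-identityʳ (f x))) (sum-map-filter P? f xs)
  ... | false = sum-map-filter P? f xs

  length-filter≡sum : ∀ {ℓ} {P : U.Pred A ℓ} (P? : U.Decidable P) xs →
                  length (filter P? xs) ≡ sumˡ (map (ind ∘ P?) xs)
  length-filter≡sum P? []       = refl
  length-filter≡sum P? (x ∷ xs) with does (P? x)
  ... | true  = cong suc (length-filter≡sum P? xs)
  ... | false = length-filter≡sum P? xs

  sum-map-tabulate : ∀ {n} (f : A → ℕ) (g : Fin n → A) → sumˡ (map f (tabulate g)) ≡ sum (f ∘ g)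
  sum-map-tabulate {zero}  f g = refl
  sum-map-tabulate {suc n} f g = cong (_+_ (f (g zero))) (sum-map-tabulate f (g ∘ suc))

  sum-map-applyUpTo : ∀ n (f : A → ℕ) (g : ℕ → A) → sumˡ (map f (applyUpTo g n)) ≡ sum {n} (λ i → f (g (toℕ i)))
  sum-map-applyUpTo zero    f g = refl
  sum-map-applyUpTo (suc n) f g = cong (_+_ (f (g 0))) (sum-map-applyUpTo n f (g ∘ suc))

  sum-map-+ : ∀ (f g : A → ℕ) xs → sumˡ (map (λ x → f x + g x) xs) ≡ sumˡ (map f xs) + sumˡ (map g xs)
  sum-map-+ f g []       = refl
  sum-map-+ f g (x ∷ xs) = trans (cong (_+_ (f x + g x)) (sum-map-+ f g xs)) (swap (f x) (g x) _ _)
    where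
    swap : ∀ a b c d → a + b + (c + d) ≡ a + c + (b + d)
    swap = solve-∀

sum-map-cartesianProduct : ∀ {A B : Set} (f : A × B → ℕ) xs ys →
  sumˡ (map f (cartesianProduct xs ys)) ≡ sumˡ (map (λ x → sumˡ (map (λ y → f (x , y)) ys)) xs)
sum-map-cartesianProduct f []       ys = refl
sum-map-cartesianProduct f (x ∷ xs) ys =
  trans (cong sumˡ (map-++ f (map (x ,_) ys) _))
  (trans (sum-++ (map f (map (x ,_) ys)) _)
    (cong₂ _+_ (cong sumˡ (sym (map-∘ ys))) (sum-map-cartesianProduct f xs ys)))

sum-const : ∀ n k → sum {n} (λ _ → k) ≡ n * k
sum-const zero    k = refl
sum-const (suc n) k = cong (_+_ k) (sum-const n k)

sum-single : ∀ {n} (u : Fin n) (f : Fin n → ℕ) → sum (λ v → ind (u Fin.≟ v) * f v) ≡ f u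
sum-single {suc n} zero f = trans (cong₂ _+_ (ℕ.+-identityʳ (f zero)) (trans (sum-const n 0) (ℕ.*-zeroʳ n))) (ℕ.+-identityʳ (f zero))
sum-single (suc u) f = sum-single u (f ∘ suc)

-- Fixing the length n lets it be inferred, which for sum alone it is not, as sum unfolds to a fold.
module FinSum (n : ℕ) where

  ∑ : (Fin n → ℕ) → ℕ
  ∑ = sum

  ∑-cong : ∀ {f g} → (∀ u → f u ≡ g u) → ∑ f ≡ ∑ g
  ∑-cong = sum-cong-≗

  ∑-+ : ∀ f g → ∑ (λ u → f u + g u) ≡ ∑ f + ∑ g
  ∑-+ = ∑-distrib-+

  ∑-*ˡ : ∀ k f → ∑ (λ u → k * f u) ≡ k * ∑ f
  ∑-*ˡ k f = sym (*-distribˡ-sum k f)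

  ∑₂ : (Fin n → Fin n → ℕ) → ℕ
  ∑₂ f = ∑ λ u → ∑ (f u)

  ∑₂-cong : ∀ {f g} → (∀ u v → f u v ≡ g u v) → ∑₂ f ≡ ∑₂ g
  ∑₂-cong eq = ∑-cong λ u → ∑-cong (eq u)

  ∑₂-swap : ∀ f → ∑₂ f ≡ ∑₂ (λ u v → f v u)
  ∑₂-swap = ∑-comm

  ∑₂-+ : ∀ f g → ∑₂ (λ u v → f u v + g u v) ≡ ∑₂ f + ∑₂ g
  ∑₂-+ f g = trans (∑-cong λ u → ∑-+ (f u) (g u)) (∑-+ (λ u → ∑ (f u)) (λ u → ∑ (g u)))

  ∑₂-* : ∀ f g → ∑₂ (λ u v → f u * g v) ≡ ∑ f * ∑ g
  ∑₂-* f g = trans (∑-cong λ u → trans (∑-*ˡ (f u) g) (ℕ.*-comm (f u) (∑ g)))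
    (trans (∑-*ˡ (∑ g) f) (ℕ.*-comm (∑ g) (∑ f)))

  -- Of the two copies of the sum over `u < v`, one is reindexed to `v < u`; together with the
  -- vanishing diagonal they tile the square.
  ∑₂-symmetric : ∀ (h : Fin n → Fin n → ℕ) → (∀ u v → h u v ≡ h v u) → (∀ u → h u u ≡ 0) →
                 2 * ∑₂ (λ u v → ind (u Fin.<? v) * h u v) ≡ ∑₂ h
  ∑₂-symmetric h h-sym h-diag = begin
    2 * L                                                      ≡⟨ cong (_+_ L) (ℕ.+-identityʳ L) ⟩
    L + L                                                      ≡⟨ cong (_+_ L) (∑₂-swap (λ u v → lt u v * h u v)) ⟩
    L + ∑₂ (λ u v → lt v u * h v u)                            ≡⟨ ∑₂-+ (λ u v → lt u v * h u v) (λ u v → lt v u * h v u) ⟨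
    ∑₂ (λ u v → lt u v * h u v + lt v u * h v u)               ≡⟨ ∑₂-cong pointwise ⟩
    ∑₂ h                                                       ∎
    where
    open ≡-Reasoning
    lt : Fin n → Fin n → ℕ
    lt u v = ind (u Fin.<? v)
    L = ∑₂ (λ u v → lt u v * h u v)
    pointwise : ∀ u v → lt u v * h u v + lt v u * h v u ≡ h u v
    pointwise u v with Fin.<-cmp u v
    ... | tri< u<v _ v≮u rewrite ind-true (u Fin.<? v) u<v | ind-false (v Fin.<? u) v≮u =
      trans (ℕ.+-identityʳ _) (ℕ.+-identityʳ _)
    ... | tri> u≮v _ v<u rewrite ind-false (u Fin.<? v) u≮v | ind-true (v Fin.<? u) v<u =
      trans (ℕ.+-identityʳ _) (h-sym v u)
    ... | tri≈ _ refl _ rewrite h-diag u = cong₂ _+_ (ℕ.*-zeroʳ (lt u u)) (ℕ.*-zeroʳ (lt u u))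

-- Weighted sums over the edges of a graph

module _ {A : Set} (z : A → ℕ) where

  both mixed none : A → A → ℕ
  both  u v = z u * z v
  mixed u v = z u * (1 ∸ z v) + (1 ∸ z u) * z v
  none  u v = (1 ∸ z u) * (1 ∸ z v)

module _ {n ℓ} (G : SimpleGraph (Fin n) ℓ) (adj? : Decidable (Adj G)) where

  open FinSum n

  degree-sum : ∀ u → degree G adj? u ≡ ∑ (λ v → ind (adj? u v))
  degree-sum u = trans (length-filter≡sum (adj? u) (allFin n)) (sum-map-tabulate (ind ∘ adj? u) id)

  edge-sum : (Fin n → Fin n → ℕ) → ℕ
  edge-sum g = sumˡ (map (λ (u , v) → g u v) (edges G adj?))

  edge-sum-cong : ∀ {f g} → (∀ u v → f u v ≡ g u v) → edge-sum f ≡ edge-sum g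
  edge-sum-cong eq = cong sumˡ (map-cong (λ (u , v) → eq u v) (edges G adj?))

  edge-sum-+ : ∀ f g → edge-sum (λ u v → f u v + g u v) ≡ edge-sum f + edge-sum g
  edge-sum-+ f g = sum-map-+ (λ (u , v) → f u v) (λ (u , v) → g u v) (edges G adj?)

  -- Edges are listed with `u < v`, an order unrelated to the ring. Passing to ordered pairs removes
  -- it, and the inner sum over `v` then runs over all of `Fin n`.
  double-edge-sum : ∀ (g : Fin n → Fin n → ℕ) → (∀ u v → g u v ≡ g v u) →
              2 * edge-sum g ≡ ∑₂ (λ u v → ind (adj? u v) * g u v)
  double-edge-sum g g-sym = trans (cong (2 *_) unfold) (∑₂-symmetric h h-sym h-diag)
    where
    open ≡-Reasoning
    h : Fin n → Fin n → ℕ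
    h u v = ind (adj? u v) * g u v
    h-sym : ∀ u v → h u v ≡ h v u
    h-sym u v = cong₂ _*_ (ind-⇔ (adj? u v) (adj? v u) (adj-sym G) (adj-sym G)) (g-sym u v)
    h-diag : ∀ u → h u u ≡ 0
    h-diag u = cong (_* g u u) (ind-false (adj? u u) (adj-irrefl G))
    P? = λ ((u , v) : Fin n × Fin n) → (u Fin.<? v) ×-dec adj? u v
    f : Fin n × Fin n → ℕ
    f (u , v) = g u v
    unfold : sumˡ (map f (edges G adj?)) ≡ ∑₂ (λ u v → ind (u Fin.<? v) * h u v)
    unfold = begin
      sumˡ (map f (filter P? (cartesianProduct (allFin n) (allFin n))))
        ≡⟨ sum-map-filter P? f (cartesianProduct (allFin n) (allFin n)) ⟩
      sumˡ (map (λ e → ind (P? e) * f e) (cartesianProduct (allFin n) (allFin n)))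
        ≡⟨ sum-map-cartesianProduct (λ e → ind (P? e) * f e) (allFin n) (allFin n) ⟩
      sumˡ (map (λ u → sumˡ (map (λ v → ind (P? (u , v)) * g u v) (allFin n))) (allFin n))
        ≡⟨ sum-map-tabulate (λ u → sumˡ (map (λ v → ind (P? (u , v)) * g u v) (allFin n))) id ⟩
      ∑ (λ u → sumˡ (map (λ v → ind (P? (u , v)) * g u v) (allFin n)))
        ≡⟨ ∑-cong (λ u → sum-map-tabulate (λ v → ind (P? (u , v)) * g u v) id) ⟩
      ∑₂ (λ u v → ind (P? (u , v)) * g u v)
        ≡⟨ ∑₂-cong (λ u v → trans (cong (_* g u v) (ind-× (u Fin.<? v) (adj? u v))) (ℕ.*-assoc (ind (u Fin.<? v)) _ _)) ⟩
      ∑₂ (λ u v → ind (u Fin.<? v) * h u v) ∎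

-- Counting multiples in an interval

∑< : ℕ → (ℕ → ℕ) → ℕ
∑< n f = sum {n} (λ i → f (toℕ i))

∑<-cong : ∀ n {f g : ℕ → ℕ} → (∀ m → f m ≡ g m) → ∑< n f ≡ ∑< n g
∑<-cong n eq = sum-cong-≗ {n} (λ i → eq (toℕ i))

∑<-snoc : ∀ n f → ∑< (suc n) f ≡ ∑< n f + f n
∑<-snoc zero    f = ℕ.+-identityʳ (f 0)
∑<-snoc (suc n) f = trans (cong (_+_ (f 0)) (∑<-snoc n (f ∘ suc))) (sym (ℕ.+-assoc (f 0) _ _))

∑<-split : ∀ m n f → ∑< (m + n) f ≡ ∑< m f + ∑< n (λ i → f (m + i))
∑<-split zero    n f = refl
∑<-split (suc m) n f = trans (cong (_+_ (f 0)) (∑<-split m n (f ∘ suc))) (sym (ℕ.+-assoc (f 0) _ _))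

Periodic : ℕ → (ℕ → ℕ) → Set
Periodic d f = ∀ m → f (d + m) ≡ f m

-- Moving the window by one place drops `f 0` and gains `f d`, which agree by periodicity. The two
-- ways of splitting `∑< (suc d) f`, at its first and at its last term, express this without
-- subtraction.
∑<-shift : ∀ {d f} → Periodic d f → ∀ c → ∑< d (λ i → f (c + i)) ≡ ∑< d f
∑<-shift         per zero    = refl
∑<-shift {d} {f} per (suc c) = trans (∑<-shift {d} {f ∘ suc} (λ m → trans (cong f (sym (ℕ.+-suc d m))) (per (suc m))) c)
  (ℕ.+-cancelˡ-≡ (f 0) _ _ (begin
    ∑< (suc d) f        ≡⟨ ∑<-snoc d f ⟩
    ∑< d f + f d        ≡⟨ cong (_+_ (∑< d f)) (trans (cong f (sym (ℕ.+-identityʳ d))) (per 0)) ⟩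
    ∑< d f + f 0        ≡⟨ ℕ.+-comm (∑< d f) (f 0) ⟩
    f 0 + ∑< d f        ∎))
  where open ≡-Reasoning

∑<-periods : ∀ k {d f} → Periodic d f → ∑< (k * d) f ≡ k * ∑< d f
∑<-periods zero            per = refl
∑<-periods (suc k) {d} {f} per = trans (∑<-split d (k * d) f) (cong (_+_ (∑< d f))
  (trans (∑<-cong (k * d) per) (∑<-periods k per)))

∣-ind : ℕ → ℕ → ℕ
∣-ind d m = ind (d ∣? m)

∣-ind-periodic : ∀ {d e} → d ∣ e → Periodic e (∣-ind d)
∣-ind-periodic {d} {e} d∣e m = ind-⇔ (d ∣? (e + m)) (d ∣? m) (λ h → ∣m+n∣m⇒∣n h d∣e) (∣m∣n⇒∣m+n d∣e)

count-multiples-period : ∀ d .{{_ : NonZero d}} → ∑< d (∣-ind d) ≡ 1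
count-multiples-period (suc d) = cong₂ _+_ (ind-true (suc d ∣? 0) (suc d ∣0))
  (trans (sum-cong-≗ {d} λ i → ind-false (suc d ∣? suc (toℕ i))
           (λ h → ℕ.<⇒≱ (s≤s (Fin.toℕ<n i)) (∣⇒≤ h)))
         (trans (sum-const d 0) (ℕ.*-zeroʳ d)))

-- The free start `c` is what the applications need: the row of a vertex `u` is a window starting at
-- `toℕ u`, and `φ` counts from 1.
count-multiples : ∀ k d .{{_ : NonZero d}} c → ∑< (k * d) (λ i → ∣-ind d (c + i)) ≡ k
count-multiples k d c = begin
  ∑< (k * d) (λ i → ∣-ind d (c + i))   ≡⟨ ∑<-shift {k * d} {∣-ind d} (∣-ind-periodic {d} (n∣m*n k)) c ⟩
  ∑< (k * d) (∣-ind d)                 ≡⟨ ∑<-periods k {d} {∣-ind d} (∣-ind-periodic {d} ∣-refl) ⟩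
  k * ∑< d (∣-ind d)                   ≡⟨ cong (k *_) (count-multiples-period d) ⟩
  k * 1                                ≡⟨ ℕ.*-identityʳ k ⟩
  k                                    ∎
  where open ≡-Reasoning

-- The total graph of ℤ/pq

prime∣prime⇒≡ : ∀ {p q} → Prime p → Prime q → p ∣ q → p ≡ q
prime∣prime⇒≡ pp pq p∣q with prime⇒irreducible pq p∣q
... | inj₁ refl = contradiction pp ¬prime[1]
... | inj₂ p≡q  = p≡q

∤⇒coprime : ∀ {p d} → Prime p → ¬ p ∣ d → Coprime d p
∤⇒coprime pp p∤d (e∣d , e∣p) with prime⇒irreducible pp e∣p
... | inj₁ e≡1 = e≡1
... | inj₂ refl = contradiction e∣d p∤d

primes-∣⇒*∣ : ∀ {p q} → Prime p → Prime q → p ≢ q → ∀ {m} → p ∣ m → q ∣ m → p * q ∣ m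
primes-∣⇒*∣ {p} {q} pp pq p≢q (divides k refl) q∣m with euclidsLemma k p pq q∣m
... | inj₁ q∣k = subst (p * q ∣_) (ℕ.*-comm p k) (*-monoʳ-∣ p q∣k)
... | inj₂ q∣p = contradiction (sym (prime∣prime⇒≡ pq pp q∣p)) p≢q

odd-prime-∣-double : ∀ {p} → Prime p → ¬ 2 ∣ p → ∀ {m} → p ∣ m + m → p ∣ m
odd-prime-∣-double {p} pp odd {m} p∣m+m
  with euclidsLemma 2 m pp (subst (p ∣_) (cong (_+_ m) (sym (ℕ.+-identityʳ m))) p∣m+m)
... | inj₂ p∣m = p∣m
... | inj₁ p∣2 = contradiction (∣-reflexive (sym (prime∣prime⇒≡ pp prime[2] p∣2))) odd

module _ (n : ℕ) .{{_ : NonZero n}} where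

  mod≡0⇒∣ : ∀ m → m mod n ≡ 0 mod n → n ∣ m
  mod≡0⇒∣ m eq = m%n≡0⇒n∣m m n (trans (sym (toℕ-mod n m)) (trans (cong toℕ eq)
    (trans (toℕ-mod n 0) (n∣m⇒m%n≡0 0 n (n ∣0)))))

  ∣⇒mod≡0 : ∀ m → n ∣ m → m mod n ≡ 0 mod n
  ∣⇒mod≡0 m n∣m = mod-cong n (trans (n∣m⇒m%n≡0 m n n∣m) (sym (n∣m⇒m%n≡0 0 n (n ∣0))))

  ≢0⇒∤ : ∀ (y : Fin n) → ¬ y ≡ 0 mod n → ¬ n ∣ toℕ y
  ≢0⇒∤ y y≢0 n∣y = y≢0 (trans (sym (mod-toℕ n y)) (∣⇒mod≡0 (toℕ y) n∣y))

  ∣toℕ-mod⇔ : ∀ {d} → d ∣ n → ∀ m → (d ∣ toℕ (m mod n) → d ∣ m) × (d ∣ m → d ∣ toℕ (m mod n))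
  ∣toℕ-mod⇔ {d} d∣n m = (λ h → ∣n∣m%n⇒∣m d∣n (subst (d ∣_) (toℕ-mod n m) h))
                      , (λ h → subst (d ∣_) (sym (toℕ-mod n m)) (%-presˡ-∣ h d∣n))

module TotalGraph (p q : ℕ) .{{_ : NonZero (p * q)}} (p-prime : Prime p) (q-prime : Prime q)
         (p-odd : ¬ 2 ∣ p) (q-odd : ¬ 2 ∣ q) (p<q : p < q) where

  open FinSum (p * q)

  private
    n = p * q
    G = T-Γ (ℤ/ n)
    adj? = T-Γ-adj? n
    instance
      p≢0 = prime⇒nonZero p-prime
      q≢0 = prime⇒nonZero q-prime
      p-nt = prime⇒nonTrivial p-prime
      q-nt = prime⇒nonTrivial q-prime

  p≢q : p ≢ q
  p≢q refl = ℕ.<-irrefl refl p<q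

  p∣n : p ∣ n
  p∣n = m∣m*n q

  q∣n : q ∣ n
  q∣n = n∣m*n p

  PQ : ℕ → Set
  PQ m = p ∣ m ⊎ q ∣ m

  PQ? : ∀ m → Dec (PQ m)
  PQ? m = (p ∣? m) ⊎-dec (q ∣? m)

  -- Pigeonhole: with two primes for the three numbers `m`, `k`, `m + k`, one prime divides two of
  -- them, and hence the third.
  PQ-+ : ∀ {m k} → PQ m → PQ k → PQ (m + k) → (p ∣ m × p ∣ k) ⊎ (q ∣ m × q ∣ k)
  PQ-+ (inj₁ a) (inj₁ b) _        = inj₁ (a , b)
  PQ-+ (inj₂ a) (inj₂ b) _        = inj₂ (a , b)
  PQ-+ (inj₁ a) (inj₂ b) (inj₁ c) = inj₁ (a , ∣m+n∣m⇒∣n c a)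
  PQ-+ {m} {k} (inj₁ a) (inj₂ b) (inj₂ c) = inj₂ (∣m+n∣m⇒∣n (subst (q ∣_) (ℕ.+-comm m k) c) b , b)
  PQ-+ (inj₂ a) (inj₁ b) (inj₂ c) = inj₂ (a , ∣m+n∣m⇒∣n c a)
  PQ-+ {m} {k} (inj₂ a) (inj₁ b) (inj₁ c) = inj₁ (∣m+n∣m⇒∣n (subst (p ∣_) (ℕ.+-comm m k) c) b , b)

  -- If neither prime divides `x`, then `x y ≡ 0` forces both to divide `y`, hence their product,
  -- and `y` would be 0.
  Z⇒PQ : ∀ x → Z (ℤ/ n) x → PQ (toℕ x)
  Z⇒PQ x (inj₁ refl) = inj₁ (proj₂ (∣toℕ-mod⇔ n p∣n 0) (p ∣0))
  Z⇒PQ x (inj₂ (y , y≢0 , xy≡0)) with PQ? (toℕ x)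
  ... | yes h = h
  ... | no ¬h = contradiction (primes-∣⇒*∣ p-prime q-prime p≢q p∣y q∣y) (≢0⇒∤ n y y≢0)
    where
    n∣xy = mod≡0⇒∣ n (toℕ x * toℕ y) xy≡0
    p∣y : p ∣ toℕ y
    p∣y with euclidsLemma (toℕ x) (toℕ y) p-prime (∣-trans p∣n n∣xy)
    ... | inj₁ p∣x = contradiction (inj₁ p∣x) ¬h
    ... | inj₂ h   = h
    q∣y : q ∣ toℕ y
    q∣y with euclidsLemma (toℕ x) (toℕ y) q-prime (∣-trans q∣n n∣xy)
    ... | inj₁ q∣x = contradiction (inj₂ q∣x) ¬h
    ... | inj₂ h   = h

  PQ⇒Z : ∀ x → PQ (toℕ x) → Z (ℤ/ n) x
  -- A multiple of `p` is annihilated by `q`, which is nonzero modulo `p * q` because `p > 1`.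
  PQ⇒Z x (inj₁ (divides k eq)) = inj₂ (q mod n , q≢0′ , trans (⊗-comm n x (q mod n))
      (trans (mod-⊗ˡ n q x) (∣⇒mod≡0 n (q * toℕ x) (divides k
        (trans (cong (q *_) eq) (swap q k p))))))
    where
    swap : ∀ a b c → a * (b * c) ≡ b * (c * a)
    swap = solve-∀
    q≢0′ : ¬ q mod n ≡ 0 mod n
    q≢0′ h = ℕ.<⇒≱ (subst (q <_) (ℕ.*-comm q p) (ℕ.m<m*n q p (ℕ.nonTrivial⇒n>1 p))) (∣⇒≤ (mod≡0⇒∣ n q h))
  PQ⇒Z x (inj₂ (divides k eq)) = inj₂ (p mod n , p≢0′ , trans (⊗-comm n x (p mod n))
      (trans (mod-⊗ˡ n p x) (∣⇒mod≡0 n (p * toℕ x) (divides k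
        (trans (cong (p *_) eq) (swap p k q))))))
    where
    swap : ∀ a b c → a * (b * c) ≡ b * (a * c)
    swap = solve-∀
    p≢0′ : ¬ p mod n ≡ 0 mod n
    p≢0′ h = ℕ.<⇒≱ (ℕ.m<m*n p q (ℕ.nonTrivial⇒n>1 q)) (∣⇒≤ (mod≡0⇒∣ n p h))

  δp δq PQ-ind : ℕ → ℕ
  δp = ∣-ind p
  δq = ∣-ind q
  PQ-ind m = ind (PQ? m)

  z : Fin n → ℕ
  z u = PQ-ind (toℕ u)

  Z-ind : ∀ x → ind (Z? n x) ≡ PQ-ind (toℕ x)
  Z-ind x = ind-⇔ (Z? n x) (PQ? (toℕ x)) (Z⇒PQ x) (PQ⇒Z x)

  -- Divisibility by a factor of `n` survives reduction modulo `n`. Adjacency can thus be read off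
  -- the integer `toℕ u + toℕ v`, and wrap-around never has to be treated.
  Z-mod-ind : ∀ m → ind (Z? n (m mod n)) ≡ PQ-ind m
  Z-mod-ind m = trans (Z-ind (m mod n)) (ind-⇔ (PQ? _) (PQ? m)
    (λ { (inj₁ h) → inj₁ (proj₁ (∣toℕ-mod⇔ n p∣n m) h) ; (inj₂ h) → inj₂ (proj₁ (∣toℕ-mod⇔ n q∣n m) h) })
    (λ { (inj₁ h) → inj₁ (proj₂ (∣toℕ-mod⇔ n p∣n m) h) ; (inj₂ h) → inj₂ (proj₂ (∣toℕ-mod⇔ n q∣n m) h) }))

  PQ-ind-double : ∀ m → PQ-ind (m + m) ≡ PQ-ind m
  PQ-ind-double m = ind-⇔ (PQ? (m + m)) (PQ? m)
    (λ { (inj₁ h) → inj₁ (odd-prime-∣-double p-prime p-odd h) ; (inj₂ h) → inj₂ (odd-prime-∣-double q-prime q-odd h) })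
    (λ { (inj₁ h) → inj₁ (∣m∣n⇒∣m+n h h) ; (inj₂ h) → inj₂ (∣m∣n⇒∣m+n h h) })

  δp*δq : ∀ m → δp m * δq m ≡ ∣-ind n m
  δp*δq m = trans (sym (ind-× (p ∣? m) (q ∣? m))) (ind-⇔ ((p ∣? m) ×-dec (q ∣? m)) (n ∣? m)
    (λ (a , b) → primes-∣⇒*∣ p-prime q-prime p≢q a b) (λ h → ∣-trans p∣n h , ∣-trans q∣n h))

  ∑δp : ∀ c → ∑< n (δp ∘ (_+_ c)) ≡ q
  ∑δp c = trans (cong (λ k → ∑< k (δp ∘ (_+_ c))) (ℕ.*-comm p q)) (count-multiples q p c)

  ∑δq : ∀ c → ∑< n (δq ∘ (_+_ c)) ≡ p
  ∑δq c = count-multiples p q c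

  ∑δpδq : ∀ c → ∑< n (λ i → δp (c + i) * δq (c + i)) ≡ 1
  ∑δpδq c = trans (∑<-cong n (λ i → δp*δq (c + i)))
    (trans (cong (λ k → ∑< k (∣-ind n ∘ (_+_ c))) (sym (ℕ.*-identityˡ n))) (count-multiples 1 n c))

  -- Any `pq` consecutive integers contain `q` multiples of `p` and `p` multiples of `q`; the `1` is
  -- the one multiple of both.
  ∑PQ-ind+1 : ∀ c → ∑< n (PQ-ind ∘ (_+_ c)) + 1 ≡ p + q
  ∑PQ-ind+1 c = begin
    ∑< n (PQ-ind ∘ (_+_ c)) + 1
      ≡⟨ cong (_+_ (∑< n (PQ-ind ∘ (_+_ c)))) (∑δpδq c) ⟨
    ∑< n (PQ-ind ∘ (_+_ c)) + ∑< n (λ i → δp (c + i) * δq (c + i))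
      ≡⟨ ∑-distrib-+ {n} (λ i → PQ-ind (c + toℕ i)) (λ i → δp (c + toℕ i) * δq (c + toℕ i)) ⟨
    ∑< n (λ i → PQ-ind (c + i) + δp (c + i) * δq (c + i))
      ≡⟨ ∑<-cong n (λ i → ind-⊎ (p ∣? (c + i)) (q ∣? (c + i))) ⟩
    ∑< n (λ i → δp (c + i) + δq (c + i))
      ≡⟨ ∑-distrib-+ {n} (λ i → δp (c + toℕ i)) (λ i → δq (c + toℕ i)) ⟩
    ∑< n (δp ∘ (_+_ c)) + ∑< n (δq ∘ (_+_ c))
      ≡⟨ cong₂ _+_ (∑δp c) (∑δq c) ⟩
    q + p
      ≡⟨ ℕ.+-comm q p ⟩
    p + q ∎
    where open ≡-Reasoning

  w : ℕ
  w = ∑ z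

  w+1 : w + 1 ≡ p + q
  w+1 = ∑PQ-ind+1 0

  ∑PQ-ind : ∀ c → ∑< n (PQ-ind ∘ (_+_ c)) ≡ w
  ∑PQ-ind c = ℕ.+-cancelʳ-≡ 1 _ _ (trans (∑PQ-ind+1 c) (sym w+1))

  coprime⇒¬PQ : ∀ {k} → Coprime k n → ¬ PQ k
  coprime⇒¬PQ c (inj₁ p∣k) = ¬prime[1] (subst Prime (c (p∣k , p∣n)) p-prime)
  coprime⇒¬PQ c (inj₂ q∣k) = ¬prime[1] (subst Prime (c (q∣k , q∣n)) q-prime)

  -- A common divisor of `k` and `p q` is coprime to `p`, so it divides `q`, and it cannot be `q`
  -- itself.
  ¬PQ⇒coprime : ∀ {k} → ¬ PQ k → Coprime k n
  ¬PQ⇒coprime ¬h {d} (d∣k , d∣n)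
    with prime⇒irreducible q-prime (coprime-divisor (∤⇒coprime p-prime (λ p∣d → ¬h (inj₁ (∣-trans p∣d d∣k)))) d∣n)
  ... | inj₁ d≡1  = d≡1
  ... | inj₂ refl = contradiction (inj₂ d∣k) ¬h

  φ+w : φ n + w ≡ n
  φ+w = begin
    φ n + w
      ≡⟨ cong (_+ w) (length-filter≡sum (λ k → coprime? k n) (map suc (upTo n))) ⟩
    sumˡ (map (λ k → ind (coprime? k n)) (map suc (upTo n))) + w
      ≡⟨ cong (λ l → sumˡ l + w) (map-∘ (upTo n)) ⟨
    sumˡ (map (λ k → ind (coprime? (suc k) n)) (upTo n)) + w
      -- `φ` ranges over 1 to `n` but `w` over 0 to `n - 1`; the window starting at 1 has the same
      -- count, so both can be summed over one range.
      ≡⟨ cong₂ _+_ (sum-map-applyUpTo n (λ k → ind (coprime? (suc k) n)) id) (sym (∑PQ-ind 1)) ⟩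
    ∑< n (λ k → ind (coprime? (suc k) n)) + ∑< n (λ k → PQ-ind (suc k))
      ≡⟨ ∑-+ (λ k → ind (coprime? (suc (toℕ k)) n)) (λ k → PQ-ind (suc (toℕ k))) ⟨
    ∑< n (λ k → ind (coprime? (suc k) n) + PQ-ind (suc k))
      ≡⟨ ∑<-cong n (λ k → trans (cong (_+ PQ-ind (suc k)) (ind-⇔ (coprime? (suc k) n) (¬? (PQ? (suc k))) coprime⇒¬PQ ¬PQ⇒coprime))
                                (ind-¬ (PQ? (suc k)))) ⟩
    ∑< n (λ _ → 1)
      ≡⟨ trans (sum-const n 1) (ℕ.*-identityʳ n) ⟩
    n ∎
    where open ≡-Reasoning

  n∸φ : p * q ∸ φ (p * q) ≡ w
  n∸φ = trans (cong (_∸ φ n) (sym φ+w)) (ℕ.m+n∸m≡n (φ n) w)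

  -- The second summand restores the diagonal that a simple graph omits; with it, the row of `u`
  -- becomes an unbroken window of `PQ-ind`.
  adj-ind : ∀ u v → ind (adj? u v) + ind (u Fin.≟ v) * z u ≡ PQ-ind (toℕ u + toℕ v)
  adj-ind u v = begin
    ind (adj? u v) + e * z u
      ≡⟨ cong (_+ e * z u) (trans (ind-× (¬? (u Fin.≟ v)) (Z? n (_⊕_ n u v))) (cong (e′ *_) (Z-mod-ind (toℕ u + toℕ v)))) ⟩
    e′ * PQ-ind (toℕ u + toℕ v) + e * z u
      ≡⟨ cong (_+_ (e′ * PQ-ind (toℕ u + toℕ v))) diagonal ⟩
    e′ * PQ-ind (toℕ u + toℕ v) + e * PQ-ind (toℕ u + toℕ v)
      ≡⟨ ℕ.*-distribʳ-+ (PQ-ind (toℕ u + toℕ v)) e′ e ⟨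
    (e′ + e) * PQ-ind (toℕ u + toℕ v)
      ≡⟨ cong (_* PQ-ind (toℕ u + toℕ v)) (ind-¬ (u Fin.≟ v)) ⟩
    1 * PQ-ind (toℕ u + toℕ v)
      ≡⟨ ℕ.*-identityˡ _ ⟩
    PQ-ind (toℕ u + toℕ v) ∎
    where
    open ≡-Reasoning
    e = ind (u Fin.≟ v)
    e′ = ind (¬? (u Fin.≟ v))
    diagonal : e * z u ≡ e * PQ-ind (toℕ u + toℕ v)
    diagonal with u Fin.≟ v
    ... | yes refl = cong (_+ 0) (sym (PQ-ind-double (toℕ u)))
    ... | no _     = refl

  degree-z : ∀ u → degree G adj? u + z u ≡ w
  degree-z u = begin
    degree G adj? u + z u
      ≡⟨ cong₂ _+_ (degree-sum G adj? u) (sym (sum-single u (λ _ → z u))) ⟩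
    ∑ (λ v → ind (adj? u v)) + ∑ (λ v → ind (u Fin.≟ v) * z u)
      ≡⟨ ∑-+ (λ v → ind (adj? u v)) (λ v → ind (u Fin.≟ v) * z u) ⟨
    ∑ (λ v → ind (adj? u v) + ind (u Fin.≟ v) * z u)
      ≡⟨ ∑-cong (adj-ind u) ⟩
    ∑< n (PQ-ind ∘ (_+_ (toℕ u)))
      ≡⟨ ∑PQ-ind (toℕ u) ⟩
    w ∎
    where open ≡-Reasoning

  degree≡ : ∀ u → degree G adj? u ≡ w ∸ z u
  degree≡ u = trans (sym (ℕ.m+n∸n≡m _ (z u))) (cong (_∸ z u) (degree-z u))

  -- The right side no longer mentions the graph: for any weight `g`, the loops missing from the
  -- adjacency are supplied by the single sum on the left.
  ∑-adj : ∀ (g : Fin n → Fin n → ℕ) →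
          ∑₂ (λ u v → ind (adj? u v) * g u v) + ∑ (λ u → z u * g u u) ≡ ∑₂ (λ u v → PQ-ind (toℕ u + toℕ v) * g u v)
  ∑-adj g = begin
    ∑₂ (λ u v → ind (adj? u v) * g u v) + ∑ (λ u → z u * g u u)
      ≡⟨ cong (_+_ (∑₂ (λ u v → ind (adj? u v) * g u v))) (∑-cong λ u → sum-single u (λ v → z u * g u v)) ⟨
    ∑₂ (λ u v → ind (adj? u v) * g u v) + ∑₂ (λ u v → ind (u Fin.≟ v) * (z u * g u v))
      ≡⟨ ∑₂-+ (λ u v → ind (adj? u v) * g u v) (λ u v → ind (u Fin.≟ v) * (z u * g u v)) ⟨
    ∑₂ (λ u v → ind (adj? u v) * g u v + ind (u Fin.≟ v) * (z u * g u v))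
      ≡⟨ ∑₂-cong (λ u v → trans (factor (ind (adj? u v)) (ind (u Fin.≟ v)) (z u) (g u v)) (cong (_* g u v) (adj-ind u v))) ⟩
    ∑₂ (λ u v → PQ-ind (toℕ u + toℕ v) * g u v) ∎
    where
    open ≡-Reasoning
    factor : ∀ a b c d → a * d + b * (c * d) ≡ (a + b * c) * d
    factor = solve-∀

  z-bit : ∀ u → z u ≡ 0 ⊎ z u ≡ 1
  z-bit u = ind-bit (PQ? (toℕ u))

  z+z′ : ∀ u → z u + (1 ∸ z u) ≡ 1
  z+z′ u with z-bit u
  ... | inj₁ eq rewrite eq = refl
  ... | inj₂ eq rewrite eq = refl

  z-idem : ∀ u → z u * z u ≡ z u
  z-idem u = ind-idem (PQ? (toℕ u))

  -- By `PQ-+`, the ordered pairs counted consist of two multiples of `p`, in `q * q` ways, or two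
  -- multiples of `q`, in `p * p` ways. Only the pair (0, 0) is of both kinds, which accounts for
  -- the `1`; the `w` is the diagonal.
  both-count : 2 * edge-sum G adj? (both z) + w + 1 ≡ q * q + p * p
  both-count = begin
    2 * edge-sum G adj? (both z) + w + 1
      -- On the diagonal the summand is the cube of the bit `z u`, hence `z u`.
      ≡⟨ cong (λ s → 2 * edge-sum G adj? (both z) + s + 1) (∑-cong λ u → sym (trans (cong (z u *_) (z-idem u)) (z-idem u))) ⟩
    2 * edge-sum G adj? (both z) + ∑ (λ u → z u * both z u u) + 1
      ≡⟨ cong (λ s → s + ∑ (λ u → z u * both z u u) + 1) (double-edge-sum G adj? (both z) (λ u v → ℕ.*-comm (z u) (z v))) ⟩
    ∑₂ (λ u v → ind (adj? u v) * both z u v) + ∑ (λ u → z u * both z u u) + 1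
      -- The overlap `1` is written as a double sum too, so that inclusion-exclusion can be applied
      -- to each pair separately.
      ≡⟨ cong₂ _+_ (∑-adj (both z)) (sym (trans (∑₂-* δpq δpq) (cong₂ _*_ (∑δpδq 0) (∑δpδq 0)))) ⟩
    ∑₂ (λ u v → PQ-ind (toℕ u + toℕ v) * both z u v) + ∑₂ (λ u v → δpq u * δpq v)
      ≡⟨ ∑₂-+ (λ u v → PQ-ind (toℕ u + toℕ v) * both z u v) (λ u v → δpq u * δpq v) ⟨
    ∑₂ (λ u v → PQ-ind (toℕ u + toℕ v) * both z u v + δpq u * δpq v)
      ≡⟨ ∑₂-cong (λ u v → pointwise (toℕ u) (toℕ v)) ⟩
    ∑₂ (λ u v → δp (toℕ u) * δp (toℕ v) + δq (toℕ u) * δq (toℕ v))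
      ≡⟨ ∑₂-+ (λ u v → δp (toℕ u) * δp (toℕ v)) (λ u v → δq (toℕ u) * δq (toℕ v)) ⟩
    ∑₂ (λ u v → δp (toℕ u) * δp (toℕ v)) + ∑₂ (λ u v → δq (toℕ u) * δq (toℕ v))
      ≡⟨ cong₂ _+_ (trans (∑₂-* (δp ∘ toℕ) (δp ∘ toℕ)) (cong₂ _*_ (∑δp 0) (∑δp 0)))
                   (trans (∑₂-* (δq ∘ toℕ) (δq ∘ toℕ)) (cong₂ _*_ (∑δq 0) (∑δq 0))) ⟩
    q * q + p * p ∎
    where
    open ≡-Reasoning
    δpq : Fin n → ℕ
    δpq u = δp (toℕ u) * δq (toℕ u)
    swap : ∀ a b c d → a * b * (c * d) ≡ a * c * (b * d)
    swap = solve-∀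
    pointwise : ∀ m k → PQ-ind (m + k) * (PQ-ind m * PQ-ind k) + δp m * δq m * (δp k * δq k) ≡ δp m * δp k + δq m * δq k
    pointwise m k = begin
      PQ-ind (m + k) * (PQ-ind m * PQ-ind k) + δp m * δq m * (δp k * δq k)
        ≡⟨ cong₂ _+_ (sym (trans (ind-× (PQ? (m + k)) (PQ? m ×-dec PQ? k)) (cong (PQ-ind (m + k) *_) (ind-× (PQ? m) (PQ? k)))))
                     (trans (swap (δp m) (δq m) (δp k) (δq k)) (cong₂ _*_ (sym (ind-× (p ∣? m) (p ∣? k))) (sym (ind-× (q ∣? m) (q ∣? k))))) ⟩
      ind (PQ? (m + k) ×-dec (PQ? m ×-dec PQ? k)) + ind P? * ind Q?
        ≡⟨ cong (_+ ind P? * ind Q?) (ind-⇔ (PQ? (m + k) ×-dec (PQ? m ×-dec PQ? k)) (P? ⊎-dec Q?)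
             (λ (h , a , b) → PQ-+ a b h)
             (λ { (inj₁ (a , b)) → inj₁ (∣m∣n⇒∣m+n a b) , inj₁ a , inj₁ b
                ; (inj₂ (a , b)) → inj₂ (∣m∣n⇒∣m+n a b) , inj₂ a , inj₂ b })) ⟩
      ind (P? ⊎-dec Q?) + ind P? * ind Q?
        ≡⟨ ind-⊎ P? Q? ⟩
      ind P? + ind Q?
        ≡⟨ cong₂ _+_ (ind-× (p ∣? m) (p ∣? k)) (ind-× (q ∣? m) (q ∣? k)) ⟩
      δp m * δp k + δq m * δq k ∎
      where
      P? = (p ∣? m) ×-dec (p ∣? k)
      Q? = (q ∣? m) ×-dec (q ∣? k)

  edge-count : 2 * (edge-sum G adj? (both z) + edge-sum G adj? (mixed z) + edge-sum G adj? (none z)) + w ≡ p * q * w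
  edge-count = begin
    2 * (edge-sum G adj? (both z) + edge-sum G adj? (mixed z) + edge-sum G adj? (none z)) + w
      ≡⟨ cong (λ s → 2 * s + w) total ⟩
    2 * edge-sum G adj? (λ _ _ → 1) + w
      ≡⟨ cong₂ _+_ (double-edge-sum G adj? (λ _ _ → 1) (λ _ _ → refl)) (∑-cong λ u → sym (ℕ.*-identityʳ (z u))) ⟩
    ∑₂ (λ u v → ind (adj? u v) * 1) + ∑ (λ u → z u * 1)
      ≡⟨ ∑-adj (λ _ _ → 1) ⟩
    ∑₂ (λ u v → PQ-ind (toℕ u + toℕ v) * 1)
      ≡⟨ ∑₂-cong (λ u v → ℕ.*-identityʳ _) ⟩
    ∑₂ (λ u v → PQ-ind (toℕ u + toℕ v))
      ≡⟨ ∑-cong (λ u → ∑PQ-ind (toℕ u)) ⟩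
    ∑ (λ _ → w)
      ≡⟨ sum-const n w ⟩
    n * w ∎
    where
    open ≡-Reasoning
    expand : ∀ a b c d → a * b + (a * d + c * b) + c * d ≡ (a + c) * (b + d)
    expand = solve-∀
    -- The three classes are the expansion of `(z u + (1 ∸ z u)) * (z v + (1 ∸ z v))`, a product of
    -- ones.
    total : edge-sum G adj? (both z) + edge-sum G adj? (mixed z) + edge-sum G adj? (none z) ≡ edge-sum G adj? (λ _ _ → 1)
    total = sym (trans
      (edge-sum-cong G adj? (λ u v → sym (trans (expand (z u) (z v) (1 ∸ z u) (1 ∸ z v)) (cong₂ _*_ (z+z′ u) (z+z′ v)))))
      (trans (edge-sum-+ G adj? (λ u v → both z u v + mixed z u v) (none z)) (cong (_+ edge-sum G adj? (none z)) (edge-sum-+ G adj? (both z) (mixed z)))))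

  -- The weight `z u + z v` is the number of ends in `Z`: 2 on a `both` edge, 1 on a `mixed` one.
  -- Over ordered pairs, each of its two terms contributes `w` for every vertex in `Z`, and the
  -- diagonal contributes `w` twice; so twice the equation is proved and the 2 cancelled.
  mixed-count : 2 * edge-sum G adj? (both z) + edge-sum G adj? (mixed z) + w ≡ w * w
  mixed-count = ℕ.*-cancelˡ-≡ _ _ 2 (begin
    2 * (2 * edge-sum G adj? (both z) + edge-sum G adj? (mixed z) + w)
      ≡⟨ double (edge-sum G adj? (both z)) (edge-sum G adj? (mixed z)) w ⟩
    2 * (edge-sum G adj? (both z) + edge-sum G adj? (both z) + edge-sum G adj? (mixed z)) + (w + w)
      ≡⟨ cong₂ _+_ (cong (2 *_) total) (cong₂ _+_ diag diag) ⟩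
    2 * edge-sum G adj? (λ u v → z u + z v) + (∑ (λ u → z u * z u) + ∑ (λ u → z u * z u))
      ≡⟨ cong₂ _+_ (double-edge-sum G adj? (λ u v → z u + z v) (λ u v → ℕ.+-comm (z u) (z v)))
           (sym (trans (∑-cong λ u → ℕ.*-distribˡ-+ (z u) (z u) (z u)) (∑-+ (λ u → z u * z u) (λ u → z u * z u)))) ⟩
    ∑₂ (λ u v → ind (adj? u v) * (z u + z v)) + ∑ (λ u → z u * (z u + z u))
      ≡⟨ ∑-adj (λ u v → z u + z v) ⟩
    ∑₂ (λ u v → PQ-ind (toℕ u + toℕ v) * (z u + z v))
      ≡⟨ ∑₂-cong (λ u v → ℕ.*-distribˡ-+ (PQ-ind (toℕ u + toℕ v)) (z u) (z v)) ⟩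
    ∑₂ (λ u v → PQ-ind (toℕ u + toℕ v) * z u + PQ-ind (toℕ u + toℕ v) * z v)
      ≡⟨ ∑₂-+ (λ u v → PQ-ind (toℕ u + toℕ v) * z u) (λ u v → PQ-ind (toℕ u + toℕ v) * z v) ⟩
    ∑₂ (λ u v → PQ-ind (toℕ u + toℕ v) * z u) + ∑₂ (λ u v → PQ-ind (toℕ u + toℕ v) * z v)
      ≡⟨ cong₂ _+_ left (trans (∑₂-swap (λ u v → PQ-ind (toℕ u + toℕ v) * z v))
           (trans (∑₂-cong (λ v u → cong (λ m → PQ-ind m * z v) (ℕ.+-comm (toℕ u) (toℕ v)))) left)) ⟩
    w * w + w * w
      ≡⟨ cong (_+_ (w * w)) (ℕ.+-identityʳ (w * w)) ⟨
    2 * (w * w) ∎)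
    where
    open ≡-Reasoning
    double : ∀ a b c → 2 * (2 * a + b + c) ≡ 2 * (a + a + b) + (c + c)
    double = solve-∀
    diag : w ≡ ∑ (λ u → z u * z u)
    diag = ∑-cong λ u → sym (z-idem u)
    expand : ∀ a b c d → a * b + a * b + (a * d + c * b) ≡ a * (b + d) + (a + c) * b
    expand = solve-∀
    total : edge-sum G adj? (both z) + edge-sum G adj? (both z) + edge-sum G adj? (mixed z) ≡ edge-sum G adj? (λ u v → z u + z v)
    total = sym (trans
      (edge-sum-cong G adj? (λ u v → sym (trans (expand (z u) (z v) (1 ∸ z u) (1 ∸ z v))
        (cong₂ _+_ (trans (cong (z u *_) (z+z′ v)) (ℕ.*-identityʳ (z u))) (trans (cong (_* z v) (z+z′ u)) (ℕ.*-identityˡ (z v)))))))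
      (trans (edge-sum-+ G adj? (λ u v → both z u v + both z u v) (mixed z)) (cong (_+ edge-sum G adj? (mixed z)) (edge-sum-+ G adj? (both z) (both z)))))
    left : ∑₂ (λ u v → PQ-ind (toℕ u + toℕ v) * z u) ≡ w * w
    left = begin
      ∑₂ (λ u v → PQ-ind (toℕ u + toℕ v) * z u)
        ≡⟨ ∑-cong (λ u → trans (∑-cong λ v → ℕ.*-comm (PQ-ind (toℕ u + toℕ v)) (z u))
             (trans (∑-*ˡ (z u) (λ v → PQ-ind (toℕ u + toℕ v))) (trans (cong (z u *_) (∑PQ-ind (toℕ u))) (ℕ.*-comm (z u) w)))) ⟩
      ∑ (λ u → w * z u)
        ≡⟨ ∑-*ˡ w z ⟩
      w * w ∎

-- From edge counts to the Sombor index

square≡ : ∀ m → m * m ≡ m * (m ∸ 1) + m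
square≡ zero    = refl
square≡ (suc m) = expand m
  where
  expand : ∀ m → suc m * suc m ≡ suc m * m + suc m
  expand = solve-∀

-- Writing `p = r + 1`, `q = s + 1` and hence `w = r + s + 1` removes all truncated subtraction and
-- leaves a polynomial identity in `r` and `s`.
mixed-arith : ∀ p q .{{_ : NonZero p}} .{{_ : NonZero q}} {w a b} → w + 1 ≡ p + q →
  a ≡ p * (p ∸ 1) + q * (q ∸ 1) → a + b + w ≡ w * w → b ≡ 2 * (p ∸ 1) * (q ∸ 1)
mixed-arith (suc r) (suc s) {w} {b = b} w+1 refl eq
  with refl ← ℕ.+-cancelʳ-≡ 1 w (suc (r + s)) (trans w+1 (trans (ℕ.+-suc (suc r) s) (ℕ.+-comm 1 (suc (r + s))))) =
  ℕ.+-cancelˡ-≡ (suc r * r + suc s * s + suc (r + s)) b _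
    (trans (swap (suc r * r + suc s * s) (suc (r + s)) b) (trans eq (expand r s)))
  where
  swap : ∀ a b c → a + b + c ≡ a + c + b
  swap = solve-∀
  expand : ∀ r s → suc (r + s) * suc (r + s) ≡ suc r * r + suc s * s + suc (r + s) + 2 * r * s
  expand = solve-∀

complement-arith : ∀ n .{{_ : NonZero n}} {e w} → e + w ≡ n * w → e ≡ (n ∸ 1) * w
complement-arith (suc m) {e} {w} eq = ℕ.+-cancelʳ-≡ w e (m * w) (trans eq (ℕ.+-comm w (m * w)))

both-weight mixed-weight none-weight : ℕ → ℝ
both-weight  s = √ ((s ∸ 1) ^ 2 + (s ∸ 1) ^ 2)
mixed-weight s = √ ((s ∸ 1) ^ 2 + s ^ 2)
none-weight  s = √ (s ^ 2 + s ^ 2)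

-- `γ` stands for `E - α - β`; as a separate argument it can be exchanged for an edge count.
formula : ℚ → ℚ → ℚ → ℕ → ℝ
formula α β γ s = √ 2 *ᴿ fromℚ α *ᴿ fromℕ (s ∸ 1)
                  +ᴿ fromℚ β *ᴿ √ ((s ∸ 1) ^ 2 + s ^ 2)
                  +ᴿ √ 2 *ᴿ fromℚ γ *ᴿ fromℕ s

-- Here termwise equality gives way to equality of limits, through `√-double-square` on the two
-- weights with equal degrees. `T` has the counts as left factors, the side on which `*ᴿ-congˡ`
-- works.
combination⇒formula : ∀ S s a b c →
  (∀ i → seq S i ≡ combination (seq (both-weight s) i) (seq (mixed-weight s) i) (seq (none-weight s) i) a b c) →
  S ≃ formula (+ a / 1) (+ b / 1) (+ c / 1) s
combination⇒formula S s a b c eq = ≃-trans S T F S≃T (≃-trans T T′ F T≃T′ (≗⇒≃ T′ F T′≗F))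
  where
  X Y W T T′ F : ℝ
  X = both-weight s
  Y = mixed-weight s
  W = none-weight s
  T = fromℕ a *ᴿ X +ᴿ fromℕ b *ᴿ Y +ᴿ fromℕ c *ᴿ W
  T′ = fromℕ a *ᴿ (√ 2 *ᴿ fromℕ (s ∸ 1)) +ᴿ fromℕ b *ᴿ Y +ᴿ fromℕ c *ᴿ (√ 2 *ᴿ fromℕ s)
  F = formula (+ a / 1) (+ b / 1) (+ c / 1) s

  flip : ∀ x y w a b c → x ℚ.* a ℚ.+ y ℚ.* b ℚ.+ w ℚ.* c ≡ a ℚ.* x ℚ.+ b ℚ.* y ℚ.+ c ℚ.* w
  flip x y w a b c = cong₂ ℚ._+_ (cong₂ ℚ._+_ (ℚ.*-comm x a) (ℚ.*-comm y b)) (ℚ.*-comm w c)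

  S≃T : S ≃ T
  S≃T = ≗⇒≃ S T λ i → trans (eq i) (flip (seq X i) (seq Y i) (seq W i) (+ a / 1) (+ b / 1) (+ c / 1))

  T≃T′ : T ≃ T′
  T≃T′ = +ᴿ-cong
    (fromℕ a *ᴿ X +ᴿ fromℕ b *ᴿ Y) (fromℕ a *ᴿ (√ 2 *ᴿ fromℕ (s ∸ 1)) +ᴿ fromℕ b *ᴿ Y)
    (fromℕ c *ᴿ W) (fromℕ c *ᴿ (√ 2 *ᴿ fromℕ s))
    (+ᴿ-cong
      (fromℕ a *ᴿ X) (fromℕ a *ᴿ (√ 2 *ᴿ fromℕ (s ∸ 1)))
      (fromℕ b *ᴿ Y) (fromℕ b *ᴿ Y)
      (*ᴿ-congˡ (+ a / 1) X (√ 2 *ᴿ fromℕ (s ∸ 1)) (√-double-square (s ∸ 1)))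
      (≗⇒≃ (fromℕ b *ᴿ Y) (fromℕ b *ᴿ Y) λ _ → refl))
    (*ᴿ-congˡ (+ c / 1) W (√ 2 *ᴿ fromℕ s) (√-double-square s))

  rotate : ∀ k r t → k ℚ.* (r ℚ.* t) ≡ r ℚ.* k ℚ.* t
  rotate k r t = trans (sym (ℚ.*-assoc k r t)) (cong (ℚ._* t) (ℚ.*-comm k r))

  T′≗F : seq T′ ≗ seq F
  T′≗F i = cong₂ ℚ._+_
    (cong (ℚ._+ (+ b / 1) ℚ.* seq Y i) (rotate (+ a / 1) (approx 2 i) (+ (s ∸ 1) / 1)))
    (rotate (+ c / 1) (approx 2 i) (+ s / 1))

-- The subtraction happens in `ℚ`, where it is exact, so no inequality between the counts has to be
-- shown.
remainder≡ : ∀ a b c {x y e} → 2 * a ≡ x → b ≡ y → 2 * (a + b + c) ≡ e →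
             + c / 1 ≡ + e / 2 - + x / 2 - + y / 1
remainder≡ a b c {x} {y} {e} 2a≡x refl 2abc≡e = trans (cancel (+ a / 1) (+ b / 1) (+ c / 1))
  (cong (_- + b / 1) (cong₂ _-_
    (trans (sym (trans (/1-homo-+ (a + b) c) (cong (ℚ._+ + c / 1) (/1-homo-+ a b)))) (sym (half-double {a + b + c} 2abc≡e)))
    (sym (half-double {a} 2a≡x))))
  where
  open +-*-Solver
  cancel : ∀ a b c → c ≡ (a ℚ.+ b ℚ.+ c) - a - b
  cancel = solve 3 (λ a b c → c := (a :+ b :+ c) :+ (:- a) :+ (:- b)) refl

counts⇒formula : ∀ S a b c {x y e s t} →
  (∀ i → seq S i ≡ combination (seq (both-weight s) i) (seq (mixed-weight s) i) (seq (none-weight s) i) a b c) →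
  2 * a ≡ x → b ≡ y → 2 * (a + b + c) ≡ e → t ≡ s →
  S ≃ formula (+ x / 2) (+ y / 1) (+ e / 2 - + x / 2 - + y / 1) t
counts⇒formula S a b c {x} {y} {s = s} eq 2a≡x b≡y 2abc≡e refl =
  subst (λ γ → S ≃ formula (+ x / 2) (+ y / 1) γ s) (remainder≡ a b c 2a≡x b≡y 2abc≡e)
    (subst₂ (λ α β → S ≃ formula α β (+ c / 1) s) (sym (half-double {a} 2a≡x)) (cong (λ b → + b / 1) b≡y)
      (combination⇒formula S s a b c eq))

weight-class : ∀ s {x y} → x ≡ 0 ⊎ x ≡ 1 → y ≡ 0 ⊎ y ≡ 1 → ∀ i → approx ((s ∸ x) ^ 2 + (s ∸ y) ^ 2) i ≡
  combination (seq (both-weight s) i) (seq (mixed-weight s) i) (seq (none-weight s) i)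
              (x * y) (x * (1 ∸ y) + (1 ∸ x) * y) ((1 ∸ x) * (1 ∸ y))
weight-class s x∈01 y∈01 i = go x∈01 y∈01
  where
  X = seq (both-weight s) i
  Y = seq (mixed-weight s) i
  W = seq (none-weight s) i
  go : ∀ {x y} → x ≡ 0 ⊎ x ≡ 1 → y ≡ 0 ⊎ y ≡ 1 → approx ((s ∸ x) ^ 2 + (s ∸ y) ^ 2) i ≡
       combination X Y W (x * y) (x * (1 ∸ y) + (1 ∸ x) * y) ((1 ∸ x) * (1 ∸ y))
  go (inj₁ refl) (inj₁ refl) = combination-001 X Y W
  -- `mixed-weight` has the smaller degree first, so this orientation of the edge needs its squares
  -- swapped.
  go (inj₁ refl) (inj₂ refl) = trans (cong (λ m → approx m i) (ℕ.+-comm (s ^ 2) ((s ∸ 1) ^ 2))) (combination-010 X Y W)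
  go (inj₂ refl) (inj₁ refl) = combination-010 X Y W
  go (inj₂ refl) (inj₂ refl) = combination-100 X Y W

-- As `m * m` is `m * (m ∸ 1) + m`, the squares on the right carry a linear part `p + q`, which
-- cancels against `w + 1`.
both-arith : ∀ p q {w a} → w + 1 ≡ p + q → 2 * a + w + 1 ≡ q * q + p * p → 2 * a ≡ p * (p ∸ 1) + q * (q ∸ 1)
both-arith p q {w} {a} w+1 eq = ℕ.+-cancelʳ-≡ (p + q) _ _ (begin
  2 * a + (p + q)                                ≡⟨ cong (λ s → 2 * a + s) w+1 ⟨
  2 * a + (w + 1)                                ≡⟨ ℕ.+-assoc (2 * a) w 1 ⟨
  2 * a + w + 1                                  ≡⟨ eq ⟩
  q * q + p * p                                  ≡⟨ cong₂ _+_ (square≡ q) (square≡ p) ⟩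
  q * (q ∸ 1) + q + (p * (p ∸ 1) + p)            ≡⟨ swap (q * (q ∸ 1)) q (p * (p ∸ 1)) p ⟩
  p * (p ∸ 1) + q * (q ∸ 1) + (p + q)            ∎)
  where
  open ≡-Reasoning
  swap : ∀ a b c d → a + b + (c + d) ≡ c + a + (d + b)
  swap = solve-∀

edges-arith : ∀ p q .{{_ : NonZero (p * q)}} {w e} → w + 1 ≡ p + q → e + w ≡ p * q * w → e ≡ (p * q ∸ 1) * (p + q ∸ 1)
edges-arith p q {w} w+1 eq = trans (complement-arith (p * q) eq)
    (cong ((p * q ∸ 1) *_) (trans (sym (ℕ.m+n∸n≡m w 1)) (cong (_∸ 1) w+1)))

counts-formula : ∀ p q .{{_ : NonZero p}} .{{_ : NonZero q}} .{{_ : NonZero (p * q)}} S w a b c {t} →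
  (∀ i → seq S i ≡ combination (seq (both-weight w) i) (seq (mixed-weight w) i) (seq (none-weight w) i) a b c) →
  w + 1 ≡ p + q → 2 * a + w + 1 ≡ q * q + p * p → 2 * a + b + w ≡ w * w → 2 * (a + b + c) + w ≡ p * q * w → t ≡ w →
  S ≃ formula (+ (p * (p ∸ 1) + q * (q ∸ 1)) / 2) (+ (2 * (p ∸ 1) * (q ∸ 1)) / 1)
    (+ ((p * q ∸ 1) * (p + q ∸ 1)) / 2 - + (p * (p ∸ 1) + q * (q ∸ 1)) / 2 - + (2 * (p ∸ 1) * (q ∸ 1)) / 1) t
counts-formula p q S w a b c eq w+1 both mixed total t≡w =
  counts⇒formula S a b c eq 2a (mixed-arith p q w+1 2a mixed) (edges-arith p q w+1 total) t≡w
  where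
  2a : 2 * a ≡ p * (p ∸ 1) + q * (q ∸ 1)
  2a = both-arith p q {w} {a} w+1 both

-- Graphs whose degrees are `w` or `w ∸ 1`

module _ {n ℓ} (G : SimpleGraph (Fin n) ℓ) (adj? : Decidable (Adj G)) (w : ℕ) (z : Fin n → ℕ)
         (z-bit : ∀ u → z u ≡ 0 ⊎ z u ≡ 1) (degree≡ : ∀ u → degree G adj? u ≡ w ∸ z u) where

  edge-weight : Fin n → Fin n → ℝ
  edge-weight u v = √ (degree G adj? u ^ 2 + degree G adj? v ^ 2)

  edge-weight-class : ∀ u v i → seq (edge-weight u v) i ≡
    combination (seq (both-weight w) i) (seq (mixed-weight w) i) (seq (none-weight w) i) (both z u v) (mixed z u v) (none z u v)
  edge-weight-class u v i = trans
    (cong₂ (λ d d′ → approx (d ^ 2 + d′ ^ 2) i) (degree≡ u) (degree≡ v))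
    (weight-class w (z-bit u) (z-bit v) i)

  SO-combination : ∀ i → seq (SO G adj?) i ≡
    combination (seq (both-weight w) i) (seq (mixed-weight w) i) (seq (none-weight w) i)
                (edge-sum G adj? (both z)) (edge-sum G adj? (mixed z)) (edge-sum G adj? (none z))
  SO-combination = foldr-combination (λ (u , v) → edge-weight u v) (both-weight w) (mixed-weight w) (none-weight w)
    (λ (u , v) → both z u v) (λ (u , v) → mixed z u v) (λ (u , v) → none z u v)
    (λ (u , v) → edge-weight-class u v) (edges G adj?)

  SO-formula : ∀ p q .{{_ : NonZero p}} .{{_ : NonZero q}} .{{_ : NonZero (p * q)}} {t} →
    w + 1 ≡ p + q →
    2 * edge-sum G adj? (both z) + w + 1 ≡ q * q + p * p →
    2 * edge-sum G adj? (both z) + edge-sum G adj? (mixed z) + w ≡ w * w →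
    2 * (edge-sum G adj? (both z) + edge-sum G adj? (mixed z) + edge-sum G adj? (none z)) + w ≡ p * q * w →
    t ≡ w →
    SO G adj? ≃
      √ 2 *ᴿ fromℚ (+ (p * (p ∸ 1) + q * (q ∸ 1)) / 2) *ᴿ fromℕ (t ∸ 1)
      +ᴿ fromℚ (+ (2 * (p ∸ 1) * (q ∸ 1)) / 1) *ᴿ √ ((t ∸ 1) ^ 2 + t ^ 2)
      +ᴿ √ 2 *ᴿ fromℚ (+ ((p * q ∸ 1) * (p + q ∸ 1)) / 2 - + (p * (p ∸ 1) + q * (q ∸ 1)) / 2 - + (2 * (p ∸ 1) * (q ∸ 1)) / 1) *ᴿ fromℕ t
  SO-formula p q = counts-formula p q (SO G adj?) w
    (edge-sum G adj? (both z)) (edge-sum G adj? (mixed z)) (edge-sum G adj? (none z)) SO-combination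

theorem3p2 : (p q : ℕ) .{{_ : NonZero (p * q)}} → Prime p → Prime q → ¬ (2 ∣ p) → ¬ (2 ∣ q) → p < q →
    let n = p * q
        α = + (p * (p ∸ 1) + q * (q ∸ 1)) / 2
        β = + (2 * (p ∸ 1) * (q ∸ 1)) / 1
        E = + ((p * q ∸ 1) * (p + q ∸ 1)) / 2
    in SO (T-Γ (ℤ/ n)) (T-Γ-adj? n)
       ≃ √ 2 *ᴿ fromℚ α *ᴿ fromℕ (n ∸ φ n ∸ 1)
         +ᴿ fromℚ β *ᴿ √ ((n ∸ φ n ∸ 1) ^ 2 + (n ∸ φ n) ^ 2)
         +ᴿ √ 2 *ᴿ fromℚ (E - α - β) *ᴿ fromℕ (n ∸ φ n)
theorem3p2 p q p-prime q-prime p-odd q-odd p<q =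
  SO-formula (T-Γ (ℤ/ (p * q))) (T-Γ-adj? (p * q)) w z z-bit degree≡ p q
    {{prime⇒nonZero p-prime}} {{prime⇒nonZero q-prime}} {p * q ∸ φ (p * q)}
    w+1 both-count mixed-count edge-count n∸φ
  where
  open TotalGraph p q p-prime q-prime p-odd q-odd p<q
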